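{- For all non-negative integers $n,k$: $\mathcal B_{n,k}\in\mathbb Z$, and $\mathcal B_{n,k}=0$ whenever $n-k$ is odd. Moreover, for all integers $n\ge 0$ and $x\ge n$, $$\mathcal B_{x,x-n}=\sum_{u\ge0}\binom{n+x}{n-u}\binom{n-x}{n+u}\mathcal A_{n+u,u},\qquad \mathcal A_{x,x-n}=\sum_{u\ge0}\binom{n+x}{n-u}\binom{n-x}{n+u}\mathcal B_{n+u,u}.$$
   Context: Conventions: $B_h$ are the Bernoulli numbers ($\frac{t}{e^t-1}=\sum_{h\ge0}B_h\frac{t^h}{h!}$, so $B_1=-\tfrac12$); binomial coefficients $\binom{N}{h}$ for any integer $N$ are defined by $\sum_h\binom{N}{h}x^h=(1+x)^N$ (so they vanish for $h<0$, and $\binom{ -N}{h}=(-1)^h\binom{N+h-1}{N-1}$ for $N>0$); $0^0=1$. ${n\brack m}$ is the unsigned Stirling number of the first kind, $\sum_m{n\brack m}y^m=\prod_{j=0}^{n-1}(y+j)$; ${n\brace m}$ is the Stirling number of the second kind, $\sum_{n\ge0}{n\brace m}\frac{y^n}{n!}=\frac{(e^y-1)^m}{m!}$; both vanish for $m>n$ or $m<0$. Define, for non-negative integers $n,k$, $$\mathcal A_{n,k}:=\sum_{h\ge 0}B_h\binom{k+h-1}{h}{n\brack h+k}n^h,\qquad \mathcal B_{n,k}:=\sum_{h\ge0}B_h\binom{n}{h}{n-h\brace k}k^h.$$ -}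

module Defs where

open import Data.Nat as ℕ using (ℕ; zero; suc; _∸_)
open import Data.Nat.Combinatorics using (_C_)
open import Data.Integer as ℤ using (ℤ; +_; -[1+_])
open import Data.Rational as ℚ using (ℚ; 0ℚ; 1ℚ)
open import Data.List using (List; []; _∷_; _++_; [_])

toℚ : ℤ → ℚ
toℚ z = z ℚ./ 1

sumℚ : ℕ → (ℕ → ℚ) → ℚ
sumℚ zero    f = f 0
sumℚ (suc m) f = sumℚ m f ℚ.+ f (suc m)

-- generalised binomial coefficient binom(N, h) for N ∈ ℤ, h ∈ ℕ
-- (coefficient of x^h in (1+x)^N); for N = -(m+1):
-- binom(-(m+1), h) = (-1)^h binom(m+h, m) = (-1)^h binom(m+h, h)
binomℤ : ℤ → ℕ → ℤ
binomℤ (+ n)     h = + (n C h)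
binomℤ -[1+ m ]  h = (ℤ.- ℤ.1ℤ) ℤ.^ h ℤ.* + ((m ℕ.+ h) C h)

stirling1 : ℕ → ℕ → ℕ
stirling1 zero    zero    = 1
stirling1 zero    (suc m) = 0
stirling1 (suc n) zero    = 0
stirling1 (suc n) (suc m) = n ℕ.* stirling1 n (suc m) ℕ.+ stirling1 n m

stirling2 : ℕ → ℕ → ℕ
stirling2 zero    zero    = 1
stirling2 zero    (suc m) = 0
stirling2 (suc n) zero    = 0
stirling2 (suc n) (suc m) = suc m ℕ.* stirling2 n (suc m) ℕ.+ stirling2 n m

-- Bernoulli numbers with B₁ = -1/2:
-- B₀ = 1,  B_m = -(1/(m+1)) Σ_{j<m} binom(m+1, j) B_j
private
  index : List ℚ → ℕ → ℚ
  index []       _       = 0ℚ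
  index (x ∷ xs) zero    = x
  index (x ∷ xs) (suc i) = index xs i

  bernList : ℕ → List ℚ
  bernList zero    = [ 1ℚ ]
  bernList (suc m) = bernList m ++ [ next ]
    where
    next : ℚ
    next = ((ℤ.- ℤ.1ℤ) ℚ./ suc (suc m))
           ℚ.* sumℚ m (λ j → toℚ (+ ((suc (suc m)) C j)) ℚ.* index (bernList m) j)

bernoulli : ℕ → ℚ
bernoulli m = index (bernList m) m

-- 𝒜_{n,k} = Σ_{h≥0} B_h binom(k+h-1, h) [n, h+k] n^h
-- (terms with h > n vanish since [n, h+k] = 0, so the sum is over 0 ≤ h ≤ n)
𝒜 : ℕ → ℕ → ℚ
𝒜 n k = sumℚ n (λ h →
  bernoulli h ℚ.* toℚ (binomℤ (+ k ℤ.+ + h ℤ.- ℤ.1ℤ) h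
                        ℤ.* + (stirling1 n (h ℕ.+ k) ℕ.* n ℕ.^ h)))

-- ℬ_{n,k} = Σ_{h≥0} B_h binom(n, h) {n-h, k} k^h
-- (terms with h > n vanish since binom(n,h) = 0)
ℬ : ℕ → ℕ → ℚ
ℬ n k = sumℚ n (λ h →
  bernoulli h ℚ.* toℚ (+ ((n C h) ℕ.* stirling2 (n ∸ h) k ℕ.* k ℕ.^ h)))

{-# OPTIONS --safe #-}
module Submission where

-- As exponential generating functions in the first index, ℬ(·,k) is (k y/(e^{ky} − 1)) (e^y − 1)^k/k!.
-- Replacing y by −y multiplies it by (−1)^k, which is the parity statement. Multiplying it by
-- Σ_{l<k} e^{ly} cancels the pole and leaves y (e^y − 1)^{k−1}/(k−1)!, so the denominators of ℬ
-- divide powers of k; on the other hand the denominators of k^h B_h are coprime to k, whence ℬ is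
-- integral. For the reciprocity, both ℬ(n+k,k) and 𝒜(n+k,k) are, up to factorials, values of one and
-- the same polynomial of degree ≤ n vanishing at 0 (if n > 0), at k and at −(n+k) respectively; the
-- two formulas are Lagrange interpolation of it at −(n+1), …, −2n and at 1, …, n.

open import Defs
open import Algebra.Bundles using (CommutativeMonoid)
import Algebra.Properties.CommutativeSemigroup as CommutativeSemigroupProperties
open import Algebra.Properties.Group using (∙-cancelʳ)
open import Data.Integer as ℤ using (ℤ; +_; -[1+_])
import Data.Integer.Properties as ℤₚ
import Data.Integer.Tactic.RingSolver as ℤSolver
open import Data.List using (List; []; _∷_; _++_; length; [_])
open import Data.List.Properties using (length-++)
open import Data.Maybe using (Maybe; just; nothing)
open import Data.Nat as ℕ using (ℕ; zero; suc; _∸_; _≤_; _<_; z≤n; s≤s; _!)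
open import Data.Nat.Combinatorics using (_C_; nCn≡1; nC1≡n; nCk+nC[k+1]≡[n+1]C[k+1]; nCk≡nC[n∸k]; k>n⇒nCk≡0; nCk≡n!/k![n-k]!; k![n∸k]!∣n!)
open import Data.Nat.DivMod using (m/n*n≡m)
open import Data.Nat.Induction using (<-rec)
import Data.Nat.Properties as ℕₚ
import Data.Nat.Tactic.RingSolver as ℕSolver
open import Data.Product using (_×_; _,_; ∃-syntax; Σ-syntax; proj₁; proj₂)
open import Data.Rational as ℚ using (ℚ; 0ℚ; 1ℚ; _+_; _*_; _-_; -_)
import Data.Rational.Properties as ℚₚ
open import Data.Rational.Unnormalised as ℚᵘ using (mkℚᵘ; *≡*)
import Data.Rational.Unnormalised.Properties as ℚᵘₚ
open import Level using (0ℓ)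
open import Relation.Binary.PropositionalEquality using (_≡_; refl; sym; trans; cong; cong₂; subst; module ≡-Reasoning; _≗_; _→-setoid_)
open import Relation.Nullary using (yes; no)
open import Tactic.RingSolver using (solve-∀)
open import Tactic.RingSolver.Core.AlmostCommutativeRing using (AlmostCommutativeRing; fromCommutativeRing)

open CommutativeSemigroupProperties (CommutativeMonoid.commutativeSemigroup ℚₚ.+-0-commutativeMonoid) using () renaming (interchange to +-interchange; x∙yz≈y∙xz to +-left-comm)
open CommutativeSemigroupProperties (CommutativeMonoid.commutativeSemigroup ℚₚ.*-1-commutativeMonoid) using () renaming (interchange to *-interchange; x∙yz≈y∙xz to *-left-comm; xy∙z≈xz∙y to *-right-comm)


-- The common polynomial is the coefficient of y^n in (t y/(e^{ty} - 1)) ((e^y - 1)/y)^t. At t = k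
-- the link with ℬ is plain. That negative t produces 𝒜 is the duality of the two kinds of Stirling
-- numbers: the coefficients P_m(t) of ((e^y - 1)/y)^t satisfy one functional equation, relating
-- P_{m+1}(t+1), P_{m+1}(t) and P_m(t+1), which becomes the recurrence of the second kind at
-- positive integers and that of the first kind at negative ones. The root at 0 makes the counting
-- right: after division by t the degree is at most n - 1, so the n values belonging to u = 1, ...,
-- n determine the quotient, and the products of two binomials are its Lagrange weights up to
-- factorials. Integrality does not go prime by prime: a rational that becomes an integer both after
-- multiplication by a power of k and after multiplication by some 1 - k a is an integer, because
-- these two factors generate the unit ideal.

ℚ-ring : AlmostCommutativeRing 0ℓ 0ℓ
ℚ-ring = fromCommutativeRing ℚₚ.+-*-commutativeRing isZero
  where
  isZero : ∀ x → Maybe (0ℚ ≡ x)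
  isZero x with 0ℚ ℚₚ.≟ x
  ... | yes p = just p
  ... | no _  = nothing

-- Integers inside the rationals

-- Passing to unnormalised rationals removes the gcd hidden in `ℚ./`; the identities below then
-- become integer identities by cross-multiplication.
toℚᵘ-toℚ : ∀ z → ℚ.toℚᵘ (toℚ z) ℚᵘ.≃ mkℚᵘ z 0
toℚᵘ-toℚ z = ℚₚ.toℚᵘ-fromℚᵘ (mkℚᵘ z 0)

toℚ-+ : ∀ a b → toℚ (a ℤ.+ b) ≡ toℚ a + toℚ b
toℚ-+ a b = ℚₚ.toℚᵘ-injective (begin
  ℚ.toℚᵘ (toℚ (a ℤ.+ b))                     ≈⟨ toℚᵘ-toℚ (a ℤ.+ b) ⟩
  mkℚᵘ (a ℤ.+ b) 0                           ≈⟨ *≡* (lem a b) ⟩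
  mkℚᵘ a 0 ℚᵘ.+ mkℚᵘ b 0                     ≈⟨ ℚᵘₚ.+-cong (toℚᵘ-toℚ a) (toℚᵘ-toℚ b) ⟨
  ℚ.toℚᵘ (toℚ a) ℚᵘ.+ ℚ.toℚᵘ (toℚ b)         ≈⟨ ℚₚ.toℚᵘ-homo-+ (toℚ a) (toℚ b) ⟨
  ℚ.toℚᵘ (toℚ a + toℚ b)                     ∎)
  where
  open import Relation.Binary.Reasoning.Setoid ℚᵘₚ.≃-setoid
  lem : ∀ a b → (a ℤ.+ b) ℤ.* + 1 ≡ (a ℤ.* + 1 ℤ.+ b ℤ.* + 1) ℤ.* + 1
  lem = ℤSolver.solve-∀

toℚ-* : ∀ a b → toℚ (a ℤ.* b) ≡ toℚ a * toℚ b
toℚ-* a b = ℚₚ.toℚᵘ-injective (begin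
  ℚ.toℚᵘ (toℚ (a ℤ.* b))                     ≈⟨ toℚᵘ-toℚ (a ℤ.* b) ⟩
  mkℚᵘ a 0 ℚᵘ.* mkℚᵘ b 0                     ≈⟨ ℚᵘₚ.*-cong (toℚᵘ-toℚ a) (toℚᵘ-toℚ b) ⟨
  ℚ.toℚᵘ (toℚ a) ℚᵘ.* ℚ.toℚᵘ (toℚ b)         ≈⟨ ℚₚ.toℚᵘ-homo-* (toℚ a) (toℚ b) ⟨
  ℚ.toℚᵘ (toℚ a * toℚ b)                     ∎)
  where open import Relation.Binary.Reasoning.Setoid ℚᵘₚ.≃-setoid

toℚ-neg : ∀ a → toℚ (ℤ.- a) ≡ - toℚ a
toℚ-neg a = ℚₚ.toℚᵘ-injective (begin
  ℚ.toℚᵘ (toℚ (ℤ.- a))     ≈⟨ toℚᵘ-toℚ (ℤ.- a) ⟩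
  ℚᵘ.- mkℚᵘ a 0            ≈⟨ ℚᵘₚ.-‿cong (toℚᵘ-toℚ a) ⟨
  ℚᵘ.- ℚ.toℚᵘ (toℚ a)      ≈⟨ ℚₚ.toℚᵘ-homo‿- (toℚ a) ⟨
  ℚ.toℚᵘ (- toℚ a)         ∎)
  where open import Relation.Binary.Reasoning.Setoid ℚᵘₚ.≃-setoid

[z/d]*d : ∀ z d → (z ℚ./ suc d) * toℚ (+ suc d) ≡ toℚ z
[z/d]*d z d = ℚₚ.toℚᵘ-injective (begin
  ℚ.toℚᵘ ((z ℚ./ suc d) * toℚ (+ suc d))               ≈⟨ ℚₚ.toℚᵘ-homo-* (z ℚ./ suc d) (toℚ (+ suc d)) ⟩
  ℚ.toℚᵘ (z ℚ./ suc d) ℚᵘ.* ℚ.toℚᵘ (toℚ (+ suc d))     ≈⟨ ℚᵘₚ.*-cong (ℚₚ.toℚᵘ-fromℚᵘ (mkℚᵘ z d)) (toℚᵘ-toℚ (+ suc d)) ⟩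
  mkℚᵘ z d ℚᵘ.* mkℚᵘ (+ suc d) 0                       ≈⟨ *≡* (lem z (+ suc d)) ⟩
  mkℚᵘ z 0                                             ≈⟨ toℚᵘ-toℚ z ⟨
  ℚ.toℚᵘ (toℚ z)                                       ∎)
  where
  open import Relation.Binary.Reasoning.Setoid ℚᵘₚ.≃-setoid
  lem : ∀ z d → z ℤ.* d ℤ.* + 1 ≡ z ℤ.* (d ℤ.* + 1)
  lem = ℤSolver.solve-∀

ι : ℕ → ℚ
ι n = toℚ (+ n)

ι-+ : ∀ m n → ι (m ℕ.+ n) ≡ ι m + ι n
ι-+ m n = toℚ-+ (+ m) (+ n)

ι-* : ∀ m n → ι (m ℕ.* n) ≡ ι m * ι n
ι-* m n = trans (cong toℚ (ℤₚ.pos-* m n)) (toℚ-* (+ m) (+ n))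

ι-suc : ∀ n → ι (suc n) ≡ 1ℚ + ι n
ι-suc = ι-+ 1

recip : ℕ → ℚ
recip n = + 1 ℚ./ suc n

recip-inverseˡ : ∀ n → recip n * ι (suc n) ≡ 1ℚ
recip-inverseˡ = [z/d]*d (+ 1)

ι-cancelˡ : ∀ n {p q} → ι (suc n) * p ≡ ι (suc n) * q → p ≡ q
ι-cancelˡ n {p} {q} eq = trans (sym (undo p)) (trans (cong (recip n *_) eq) (undo q))
  where
  undo : ∀ p → recip n * (ι (suc n) * p) ≡ p
  undo p = trans (sym (ℚₚ.*-assoc (recip n) (ι (suc n)) p))
                 (trans (cong (_* p) (recip-inverseˡ n)) (ℚₚ.*-identityˡ p))

-- Finite sums

sum-cong-≤ : ∀ n {f g : ℕ → ℚ} → (∀ i → i ≤ n → f i ≡ g i) → sumℚ n f ≡ sumℚ n g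
sum-cong-≤ zero    f≡g = f≡g 0 z≤n
sum-cong-≤ (suc n) f≡g =
  cong₂ _+_ (sum-cong-≤ n (λ i i≤n → f≡g i (ℕₚ.m≤n⇒m≤1+n i≤n))) (f≡g (suc n) ℕₚ.≤-refl)

sum-cong : ∀ n {f g : ℕ → ℚ} → (∀ i → f i ≡ g i) → sumℚ n f ≡ sumℚ n g
sum-cong n f≡g = sum-cong-≤ n (λ i _ → f≡g i)

sum-+ : ∀ n f g → sumℚ n (λ i → f i + g i) ≡ sumℚ n f + sumℚ n g
sum-+ zero    f g = refl
sum-+ (suc n) f g = trans (cong (_+ (f (suc n) + g (suc n))) (sum-+ n f g))
  (+-interchange (sumℚ n f) (sumℚ n g) (f (suc n)) (g (suc n)))

sum-*ˡ : ∀ n c f → sumℚ n (λ i → c * f i) ≡ c * sumℚ n f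
sum-*ˡ zero    c f = refl
sum-*ˡ (suc n) c f = trans (cong (_+ c * f (suc n)) (sum-*ˡ n c f))
  (sym (ℚₚ.*-distribˡ-+ c (sumℚ n f) (f (suc n))))

sum-first : ∀ n f → sumℚ (suc n) f ≡ f 0 + sumℚ n (λ i → f (suc i))
sum-first zero    f = refl
sum-first (suc n) f = trans (cong (_+ f (suc (suc n))) (sum-first n f))
  (ℚₚ.+-assoc (f 0) (sumℚ n (λ i → f (suc i))) (f (suc (suc n))))

sum-0 : ∀ n {f : ℕ → ℚ} → (∀ i → i ≤ n → f i ≡ 0ℚ) → sumℚ n f ≡ 0ℚ
sum-0 zero    f≡0 = f≡0 0 z≤n
sum-0 (suc n) f≡0 =
  cong₂ _+_ (sum-0 n (λ i i≤n → f≡0 i (ℕₚ.m≤n⇒m≤1+n i≤n))) (f≡0 (suc n) ℕₚ.≤-refl)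

-- The recurrence of the Bernoulli numbers

-- Defs hides the table from which bernoulli is read off. Abstracting _++_ in the normal form of
-- bernoulli (suc m) lets the unifier solve for the hidden lookup function, and abstracting that
-- one in turn exposes the hidden table.
mutual
  lookupAppend : ℕ → (List ℚ → List ℚ → List ℚ) → ℚ
  lookupAppend m append = _

  bernoulli-lookupAppend : ∀ m → bernoulli (suc m) ≡ lookupAppend m _++_
  bernoulli-lookupAppend m with _++_ {A = ℚ}
  ... | append = refl

mutual
  entry : List ℚ → ℕ → ℚ
  entry xs j = _

  lookupAppend-entry : ∀ xs m → lookupAppend m (λ _ _ → xs) ≡ entry xs (suc m)
  lookupAppend-entry xs m with suc m
  ... | j = refl

mutual
  table : ℕ → List ℚ
  table m = _

  bernoulli-entry : ∀ m → bernoulli m ≡ entry (table m) m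
  bernoulli-entry m with entry
  ... | f = refl

entry-++ : ∀ xs ys {j} → j < length xs → entry (xs ++ ys) j ≡ entry xs j
entry-++ (x ∷ xs) ys {zero}  _         = refl
entry-++ (x ∷ xs) ys {suc j} (s≤s j<n) = entry-++ xs ys j<n

entry-length : ∀ xs x → entry (xs ++ [ x ]) (length xs) ≡ x
entry-length []       x = refl
entry-length (_ ∷ xs) x = entry-length xs x

length-table : ∀ m → length (table m) ≡ suc m
length-table zero    = refl
length-table (suc m) = trans (length-++ (table m)) (trans (ℕₚ.+-comm (length (table m)) 1) (cong suc (length-table m)))

-- The table grows only by appending, so an entry keeps its value once computed. This lets the
-- recurrence, which reads the table of stage m, be restated with `bernoulli` alone.
table-stable : ∀ m {j} → j ≤ m → entry (table m) j ≡ bernoulli j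
table-stable zero    z≤n = refl
table-stable (suc m) {j} j≤1+m with j ℕₚ.≟ suc m
... | yes refl = refl
... | no  j≢   = trans
  (entry-++ (table m) _ (subst (j <_) (sym (length-table m)) (ℕₚ.≤∧≢⇒< j≤1+m j≢)))
  (table-stable m (ℕₚ.≤-pred (ℕₚ.≤∧≢⇒< j≤1+m j≢)))

bernoulli-step : ∀ m → bernoulli (suc m) * ι (suc (suc m))
  ≡ - sumℚ m (λ j → ι (suc (suc m) C j) * bernoulli j)
bernoulli-step m = begin
  bernoulli (suc m) * n                 ≡⟨ cong (_* n) (trans (cong (entry (table m ++ [ r * s′ ])) (sym (length-table m))) (entry-length (table m) (r * s′))) ⟩
  r * s′ * n                            ≡⟨ cong (λ s → r * s * n) (sum-cong-≤ m (λ j j≤m → cong (ι (suc (suc m) C j) *_) (table-stable m j≤m))) ⟩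
  r * s * n                             ≡⟨ *-right-comm r s n ⟩
  r * n * s                             ≡⟨ cong (_* s) ([z/d]*d (ℤ.- ℤ.1ℤ) (suc m)) ⟩
  - 1ℚ * s                              ≡⟨ neg s ⟩
  - s                                   ∎
  where
  open ≡-Reasoning
  n = ι (suc (suc m))
  r = ℤ.- ℤ.1ℤ ℚ./ suc (suc m)
  s  = sumℚ m (λ j → ι (suc (suc m) C j) * bernoulli j)
  s′ = sumℚ m (λ j → ι (suc (suc m) C j) * entry (table m) j)
  neg : ∀ s → - 1ℚ * s ≡ - s
  neg = solve-∀ ℚ-ring

-- Exponential generating functions

Seq : Set
Seq = ℕ → ℚ

module ≗-Reasoning where
  open import Relation.Binary.Reasoning.Setoid (ℕ →-setoid ℚ) public

≗-sym : {f g : Seq} → f ≗ g → g ≗ f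
≗-sym e n = sym (e n)

≗-trans : {f g h : Seq} → f ≗ g → g ≗ h → f ≗ h
≗-trans e e′ n = trans (e n) (e′ n)

infixl 7 _⋆_
infixl 6 _⊕_
infixr 8 _·_

D : Seq → Seq
D f n = f (suc n)

_⊕_ : Seq → Seq → Seq
(f ⊕ g) n = f n + g n

_·_ : ℚ → Seq → Seq
(c · f) n = c * f n

-- The sequence f stands for the exponential generating function Σ f n yⁿ/n!, so that D is the
-- derivative; the product is defined by the Leibniz rule.
_⋆_ : Seq → Seq → Seq
(f ⋆ g) zero    = f 0 * g 0
(f ⋆ g) (suc n) = (D f ⋆ g) n + (f ⋆ D g) n

𝟘 : Seq
𝟘 _ = 0ℚ

δ : Seq
δ zero    = 1ℚ
δ (suc _) = 0ℚ

⋆-cong : ∀ {f f′ g g′} → f ≗ f′ → g ≗ g′ → f ⋆ g ≗ f′ ⋆ g′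
⋆-cong f≗ g≗ zero    = cong₂ _*_ (f≗ 0) (g≗ 0)
⋆-cong f≗ g≗ (suc n) = cong₂ _+_ (⋆-cong (λ i → f≗ (suc i)) g≗ n) (⋆-cong f≗ (λ i → g≗ (suc i)) n)

⋆-congˡ : ∀ f {g g′} → g ≗ g′ → f ⋆ g ≗ f ⋆ g′
⋆-congˡ f = ⋆-cong {f} (λ _ → refl)

⋆-congʳ : ∀ g {f f′} → f ≗ f′ → f ⋆ g ≗ f′ ⋆ g
⋆-congʳ g f≗ = ⋆-cong {g = g} f≗ (λ _ → refl)

⋆-comm : ∀ f g → f ⋆ g ≗ g ⋆ f
⋆-comm f g zero    = ℚₚ.*-comm (f 0) (g 0)
⋆-comm f g (suc n) = trans (cong₂ _+_ (⋆-comm (D f) g n) (⋆-comm f (D g) n))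
  (ℚₚ.+-comm ((g ⋆ D f) n) ((D g ⋆ f) n))

⋆-distribʳ-⊕ : ∀ h f g → (f ⊕ g) ⋆ h ≗ f ⋆ h ⊕ g ⋆ h
⋆-distribʳ-⊕ h f g zero    = ℚₚ.*-distribʳ-+ (h 0) (f 0) (g 0)
⋆-distribʳ-⊕ h f g (suc n) = trans
  (cong₂ _+_ (⋆-distribʳ-⊕ h (D f) (D g) n) (⋆-distribʳ-⊕ (D h) f g n))
  (+-interchange ((D f ⋆ h) n) ((D g ⋆ h) n) ((f ⋆ D h) n) ((g ⋆ D h) n))

⋆-distribˡ-⊕ : ∀ h f g → h ⋆ (f ⊕ g) ≗ h ⋆ f ⊕ h ⋆ g
⋆-distribˡ-⊕ h f g n = trans (⋆-comm h (f ⊕ g) n)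
  (trans (⋆-distribʳ-⊕ h f g n) (cong₂ _+_ (⋆-comm f h n) (⋆-comm g h n)))

·-⋆-assoc : ∀ c f g → (c · f) ⋆ g ≗ c · (f ⋆ g)
·-⋆-assoc c f g zero    = ℚₚ.*-assoc c (f 0) (g 0)
·-⋆-assoc c f g (suc n) = trans
  (cong₂ _+_ (·-⋆-assoc c (D f) g n) (·-⋆-assoc c f (D g) n))
  (sym (ℚₚ.*-distribˡ-+ c ((D f ⋆ g) n) ((f ⋆ D g) n)))

⋆-·-comm : ∀ c f g → f ⋆ (c · g) ≗ c · (f ⋆ g)
⋆-·-comm c f g n = trans (⋆-comm f (c · g) n)
  (trans (·-⋆-assoc c g f n) (cong (c *_) (⋆-comm g f n)))

⋆-assoc : ∀ f g h → (f ⋆ g) ⋆ h ≗ f ⋆ (g ⋆ h)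
⋆-assoc f g h zero    = ℚₚ.*-assoc (f 0) (g 0) (h 0)
⋆-assoc f g h (suc n) = begin
  ((D f ⋆ g ⊕ f ⋆ D g) ⋆ h) n + (f ⋆ g ⋆ D h) n
    ≡⟨ cong₂ _+_ (⋆-distribʳ-⊕ h (D f ⋆ g) (f ⋆ D g) n) (⋆-assoc f g (D h) n) ⟩
  (D f ⋆ g ⋆ h) n + (f ⋆ D g ⋆ h) n + (f ⋆ (g ⋆ D h)) n
    ≡⟨ cong (_+ (f ⋆ (g ⋆ D h)) n) (cong₂ _+_ (⋆-assoc (D f) g h n) (⋆-assoc f (D g) h n)) ⟩
  (D f ⋆ (g ⋆ h)) n + (f ⋆ (D g ⋆ h)) n + (f ⋆ (g ⋆ D h)) n
    ≡⟨ ℚₚ.+-assoc ((D f ⋆ (g ⋆ h)) n) ((f ⋆ (D g ⋆ h)) n) ((f ⋆ (g ⋆ D h)) n) ⟩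
  (D f ⋆ (g ⋆ h)) n + ((f ⋆ (D g ⋆ h)) n + (f ⋆ (g ⋆ D h)) n)
    ≡⟨ cong (λ z → (D f ⋆ (g ⋆ h)) n + z) (⋆-distribˡ-⊕ f (D g ⋆ h) (g ⋆ D h) n) ⟨
  (D f ⋆ (g ⋆ h)) n + (f ⋆ (D g ⋆ h ⊕ g ⋆ D h)) n
    ∎
  where open ≡-Reasoning

⋆-zeroˡ : ∀ f → 𝟘 ⋆ f ≗ 𝟘
⋆-zeroˡ f zero    = ℚₚ.*-zeroˡ (f 0)
⋆-zeroˡ f (suc n) = cong₂ _+_ (⋆-zeroˡ f n) (⋆-zeroˡ (D f) n)

⋆-identityˡ : ∀ f → δ ⋆ f ≗ f
⋆-identityˡ f zero    = ℚₚ.*-identityˡ (f 0)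
⋆-identityˡ f (suc n) = trans (cong₂ _+_ (⋆-zeroˡ f n) (⋆-identityˡ (D f) n)) (ℚₚ.+-identityˡ (f (suc n)))

⋆-swap : ∀ f g h → f ⋆ g ⋆ h ≗ f ⋆ h ⋆ g
⋆-swap f g h = ≗-trans (⋆-assoc f g h)
  (≗-trans (⋆-congˡ f (⋆-comm g h)) (≗-sym (⋆-assoc f h g)))

⋆-interchange : ∀ f g h k → (f ⋆ g) ⋆ (h ⋆ k) ≗ (f ⋆ h) ⋆ (g ⋆ k)
⋆-interchange f g h k = begin
  (f ⋆ g) ⋆ (h ⋆ k)  ≈⟨ ⋆-assoc (f ⋆ g) h k ⟨
  f ⋆ g ⋆ h ⋆ k      ≈⟨ ⋆-congʳ k (⋆-swap f g h) ⟩
  f ⋆ h ⋆ g ⋆ k      ≈⟨ ⋆-assoc (f ⋆ h) g k ⟩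
  (f ⋆ h) ⋆ (g ⋆ k)  ∎
  where open ≗-Reasoning

⋆-binomial : ∀ n f g → (f ⋆ g) n ≡ sumℚ n (λ h → ι (n C h) * (f h * g (n ∸ h)))
⋆-binomial zero    f g = sym (ℚₚ.*-identityˡ (f 0 * g 0))
⋆-binomial (suc n) f g = begin
  (D f ⋆ g) n + (f ⋆ D g) n
    ≡⟨ cong₂ _+_ (⋆-binomial n (D f) g) (⋆-binomial n f (D g)) ⟩
  A + sumℚ n (λ h → ι (n C h) * (f h * g (suc (n ∸ h))))
    ≡⟨ cong (λ z → A + z) (sum-cong-≤ n (λ h h≤n → cong (λ j → ι (n C h) * (f h * g j)) (sym (ℕₚ.+-∸-assoc 1 h≤n)))) ⟩
  A + sumℚ n t
    -- A zero term is appended so that the second sum can be split at its first term and aligned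
    -- with the first one for Pascal's rule.
    ≡⟨ cong (λ z → A + z) (trans (sym (ℚₚ.+-identityʳ (sumℚ n t))) (cong (λ z → sumℚ n t + z) (sym t-last))) ⟩
  A + sumℚ (suc n) t
    ≡⟨ cong (λ z → A + z) (sum-first n t) ⟩
  A + (t 0 + sumℚ n (λ h → t (suc h)))
    ≡⟨ +-left-comm A (t 0) (sumℚ n (λ h → t (suc h))) ⟩
  t 0 + (A + sumℚ n (λ h → t (suc h)))
    ≡⟨ cong (λ z → t 0 + z) (sum-+ n a (λ h → t (suc h))) ⟨
  t 0 + sumℚ n (λ h → a h + t (suc h))
    ≡⟨ cong (λ z → t 0 + z) (sum-cong n pascal) ⟩
  s 0 + sumℚ n (λ h → s (suc h))
    ≡⟨ sum-first n s ⟨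
  sumℚ (suc n) s
    ∎
  where
  open ≡-Reasoning
  a t s : ℕ → ℚ
  a h = ι (n C h) * (f (suc h) * g (n ∸ h))
  t h = ι (n C h) * (f h * g (suc n ∸ h))
  s h = ι (suc n C h) * (f h * g (suc n ∸ h))
  A = sumℚ n a
  t-last : t (suc n) ≡ 0ℚ
  t-last = trans (cong (λ c → ι c * (f (suc n) * g (suc n ∸ suc n))) (k>n⇒nCk≡0 (ℕₚ.n<1+n n)))
                 (ℚₚ.*-zeroˡ (f (suc n) * g (suc n ∸ suc n)))
  pascal : ∀ h → a h + t (suc h) ≡ s (suc h)
  pascal h = begin
    ι (n C h) * q + ι (n C suc h) * q    ≡⟨ ℚₚ.*-distribʳ-+ q (ι (n C h)) (ι (n C suc h)) ⟨
    (ι (n C h) + ι (n C suc h)) * q      ≡⟨ cong (_* q) (ι-+ (n C h) (n C suc h)) ⟨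
    ι (n C h ℕ.+ n C suc h) * q          ≡⟨ cong (λ c → ι c * q) (nCk+nC[k+1]≡[n+1]C[k+1] n h) ⟩
    ι (suc n C suc h) * q                ∎
    where q = f (suc h) * g (n ∸ h)

-- As a sequence this is the series e^{ay}; its values a^n also serve as the powers and signs of the
-- whole development.
exp : ℚ → Seq
exp a zero    = 1ℚ
exp a (suc n) = a * exp a n

exp-⋆ : ∀ a b → exp a ⋆ exp b ≗ exp (a + b)
exp-⋆ a b zero    = refl
exp-⋆ a b (suc n) = begin
  ((a · exp a) ⋆ exp b) n + (exp a ⋆ (b · exp b)) n  ≡⟨ cong₂ _+_ (·-⋆-assoc a (exp a) (exp b) n) (⋆-·-comm b (exp a) (exp b) n) ⟩
  a * (exp a ⋆ exp b) n + b * (exp a ⋆ exp b) n      ≡⟨ ℚₚ.*-distribʳ-+ ((exp a ⋆ exp b) n) a b ⟨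
  (a + b) * (exp a ⋆ exp b) n                        ≡⟨ cong ((a + b) *_) (exp-⋆ a b n) ⟩
  (a + b) * exp (a + b) n                            ∎
  where open ≡-Reasoning

exp-0 : exp 0ℚ ≗ δ
exp-0 zero    = refl
exp-0 (suc n) = ℚₚ.*-zeroˡ (exp 0ℚ n)

exp-1 : ∀ n → exp 1ℚ n ≡ 1ℚ
exp-1 zero    = refl
exp-1 (suc n) = trans (ℚₚ.*-identityˡ (exp 1ℚ n)) (exp-1 n)

exp-* : ∀ a b n → exp (a * b) n ≡ exp a n * exp b n
exp-* a b zero    = refl
exp-* a b (suc n) = trans (cong (a * b *_) (exp-* a b n)) (*-interchange a b (exp a n) (exp b n))

exp-ι : ∀ k n → exp (ι k) n ≡ ι (k ℕ.^ n)
exp-ι k zero    = refl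
exp-ι k (suc n) = trans (cong (ι k *_) (exp-ι k n)) (sym (ι-* k (k ℕ.^ n)))

-- Substitution of c y for y in the generating function.
scale : ℚ → Seq → Seq
scale c f n = exp c n * f n

scale-⋆ : ∀ c f g → scale c (f ⋆ g) ≗ scale c f ⋆ scale c g
scale-⋆ c f g zero    = *-interchange 1ℚ 1ℚ (f 0) (g 0)
scale-⋆ c f g (suc n) = begin
  c * exp c n * ((D f ⋆ g) n + (f ⋆ D g) n)
    ≡⟨ expand c (exp c n) ((D f ⋆ g) n) ((f ⋆ D g) n) ⟩
  c * scale c (D f ⋆ g) n + c * scale c (f ⋆ D g) n
    ≡⟨ cong₂ (λ p q → c * p + c * q) (scale-⋆ c (D f) g n) (scale-⋆ c f (D g) n) ⟩
  c * (scale c (D f) ⋆ scale c g) n + c * (scale c f ⋆ scale c (D g)) n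
    ≡⟨ cong₂ _+_ (·-⋆-assoc c (scale c (D f)) (scale c g) n) (⋆-·-comm c (scale c f) (scale c (D g)) n) ⟨
  ((c · scale c (D f)) ⋆ scale c g) n + (scale c f ⋆ (c · scale c (D g))) n
    ≡⟨ cong₂ _+_ (⋆-congʳ (scale c g) (D-scale f) n) (⋆-congˡ (scale c f) (D-scale g) n) ⟨
  (D (scale c f) ⋆ scale c g) n + (scale c f ⋆ D (scale c g)) n
    ∎
  where
  open ≡-Reasoning
  expand : ∀ c e p q → c * e * (p + q) ≡ c * (e * p) + c * (e * q)
  expand = solve-∀ ℚ-ring
  D-scale : ∀ f → D (scale c f) ≗ c · scale c (D f)
  D-scale f i = ℚₚ.*-assoc c (exp c i) (f (suc i))

scale-comm : ∀ a b f → scale a (scale b f) ≗ scale b (scale a f)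
scale-comm a b f n = *-left-comm (exp a n) (exp b n) (f n)

y : Seq
y (suc zero) = 1ℚ
y _          = 0ℚ

D-y : D y ≗ δ
D-y zero    = refl
D-y (suc n) = refl

y-⋆ : ∀ f n → (y ⋆ f) (suc n) ≡ ι (suc n) * f n
y-⋆ f n = trans (cong (_+ (y ⋆ D f) n) (trans (⋆-congʳ f D-y n) (⋆-identityˡ f n))) (rest n)
  where
  rest : ∀ n → f n + (y ⋆ D f) n ≡ ι (suc n) * f n
  rest zero    = lem (f 0) (f 1)
    where
    lem : ∀ a b → a + 0ℚ * b ≡ 1ℚ * a
    lem = solve-∀ ℚ-ring
  rest (suc n) = begin
    f (suc n) + (y ⋆ D f) (suc n)       ≡⟨ cong (λ z → f (suc n) + z) (y-⋆ (D f) n) ⟩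
    f (suc n) + ι (suc n) * f (suc n)   ≡⟨ lem (f (suc n)) (ι (suc n)) ⟩
    (1ℚ + ι (suc n)) * f (suc n)        ≡⟨ cong (_* f (suc n)) (ι-suc (suc n)) ⟨
    ι (suc (suc n)) * f (suc n)         ∎
    where
    open ≡-Reasoning
    lem : ∀ a b → a + b * a ≡ (1ℚ + b) * a
    lem = solve-∀ ℚ-ring

scale-y : ∀ c → scale c y ≗ c · y
scale-y c zero          = trans (ℚₚ.*-zeroʳ 1ℚ) (sym (ℚₚ.*-zeroʳ c))
scale-y c (suc zero)    = cong (_* 1ℚ) (ℚₚ.*-identityʳ c)
scale-y c (suc (suc n)) = trans (ℚₚ.*-zeroʳ (exp c (suc (suc n)))) (sym (ℚₚ.*-zeroʳ c))

y-cancel : ∀ {f g} → y ⋆ f ≗ y ⋆ g → f ≗ g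
y-cancel {f} {g} eq n = ι-cancelˡ n (trans (sym (y-⋆ f n)) (trans (eq (suc n)) (y-⋆ g n)))

-- The series e^y - 1. It has no constant term and hence no inverse, so division by it has to be
-- replaced by cancellation.
E : Seq
E zero    = 0ℚ
E (suc _) = 1ℚ

E⊕δ : E ⊕ δ ≗ exp 1ℚ
E⊕δ zero    = refl
E⊕δ (suc n) = sym (exp-1 (suc n))

bernoulli-⋆-E : bernoulli ⋆ E ≗ y
bernoulli-⋆-E zero    = refl
bernoulli-⋆-E (suc n) = begin
  (bernoulli ⋆ E) (suc n)
    ≡⟨ ⋆-binomial (suc n) bernoulli E ⟩
  sumℚ n (λ h → ι (suc n C h) * (bernoulli h * E (suc n ∸ h))) + ι (suc n C suc n) * (bernoulli (suc n) * E (suc n ∸ suc n))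
    ≡⟨ cong₂ _+_ (sum-cong-≤ n E≡1) last ⟩
  sumℚ n t + 0ℚ
    ≡⟨ ℚₚ.+-identityʳ (sumℚ n t) ⟩
  sumℚ n t
    ≡⟨ recurrence n ⟩
  y (suc n)
    ∎
  where
  open ≡-Reasoning
  t : ℕ → ℚ
  t h = ι (suc n C h) * bernoulli h
  E≡1 : ∀ h → h ≤ n → ι (suc n C h) * (bernoulli h * E (suc n ∸ h)) ≡ t h
  E≡1 h h≤n = cong (ι (suc n C h) *_)
    (trans (cong (λ j → bernoulli h * E j) (ℕₚ.+-∸-assoc 1 h≤n)) (ℚₚ.*-identityʳ (bernoulli h)))
  last : ι (suc n C suc n) * (bernoulli (suc n) * E (suc n ∸ suc n)) ≡ 0ℚ
  last = trans (cong (λ j → ι (suc n C suc n) * (bernoulli (suc n) * E j)) (ℕₚ.n∸n≡0 n))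
    (trans (cong (ι (suc n C suc n) *_) (ℚₚ.*-zeroʳ (bernoulli (suc n)))) (ℚₚ.*-zeroʳ (ι (suc n C suc n))))
  recurrence : ∀ n → sumℚ n (λ h → ι (suc n C h) * bernoulli h) ≡ y (suc n)
  recurrence zero    = refl
  recurrence (suc m) = begin
    s + ι (suc (suc m) C suc m) * bernoulli (suc m)
      ≡⟨ cong (λ c → s + ι c * bernoulli (suc m)) [m+2]C[m+1]≡m+2 ⟩
    s + ι (suc (suc m)) * bernoulli (suc m)
      ≡⟨ cong (λ z → s + z) (trans (ℚₚ.*-comm (ι (suc (suc m))) (bernoulli (suc m))) (bernoulli-step m)) ⟩
    s + - s
      ≡⟨ ℚₚ.+-inverseʳ s ⟩
    0ℚ
      ∎
    where
    s = sumℚ m (λ h → ι (suc (suc m) C h) * bernoulli h)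
    [m+2]C[m+1]≡m+2 : suc (suc m) C suc m ≡ suc (suc m)
    [m+2]C[m+1]≡m+2 = trans (nCk≡nC[n∸k] (ℕₚ.n≤1+n (suc m)))
      (trans (cong (suc (suc m) C_) (ℕₚ.m+n∸n≡m 1 (suc m))) (nC1≡n (suc (suc m))))

-- Multiplying by `bernoulli` turns the factor `E` into y, and a factor y is cancelled coefficient
-- by coefficient.
E-cancel : ∀ {f g} → f ⋆ E ≗ g ⋆ E → f ≗ g
E-cancel {f} {g} eq = y-cancel (≗-trans (y⋆ f) (≗-trans (⋆-congʳ bernoulli eq) (≗-sym (y⋆ g))))
  where
  open ≗-Reasoning
  y⋆ : ∀ f → y ⋆ f ≗ f ⋆ E ⋆ bernoulli
  y⋆ f = begin
    y ⋆ f                ≈⟨ ⋆-comm y f ⟩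
    f ⋆ y                ≈⟨ ⋆-congˡ f bernoulli-⋆-E ⟨
    f ⋆ (bernoulli ⋆ E)  ≈⟨ ⋆-congˡ f (⋆-comm bernoulli E) ⟩
    f ⋆ (E ⋆ bernoulli)  ≈⟨ ⋆-assoc f E bernoulli ⟨
    f ⋆ E ⋆ bernoulli    ∎

-- Parity

-- The series (e^y - 1)^k/k!.
S : ℕ → Seq
S k n = ι (stirling2 n k)

D-S : ∀ k → D (S (suc k)) ≗ ι (suc k) · S (suc k) ⊕ S k
D-S k n = trans (ι-+ (suc k ℕ.* stirling2 n (suc k)) (stirling2 n k))
  (cong (_+ S k n) (ι-* (suc k) (stirling2 n (suc k))))

-- The factor k + 1 comes from the factorials in (e^y - 1)^k/k!. Both sides vanish at y = 0;
-- comparing derivatives reduces the coefficient at `suc n` to the coefficients at `n` of the same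
-- identity for k and k - 1.
E-⋆-S : ∀ k → E ⋆ S k ≗ ι (suc k) · S (suc k)
E-⋆-S k zero    = trans (ℚₚ.*-zeroˡ (S k 0)) (sym (ℚₚ.*-zeroʳ (ι (suc k))))
E-⋆-S k (suc n) = begin
  (D E ⋆ S k) n + (E ⋆ D (S k)) n
    ≡⟨ cong₂ _+_ D-E-⋆ (E-⋆-D k) ⟩
  (a + S k n) + ι k * (a + S k n)
    ≡⟨ cong (λ a → (a + S k n) + ι k * (a + S k n)) (E-⋆-S k n) ⟩
  (c * s + S k n) + ι k * (c * s + S k n)
    ≡⟨ collect (ι k) (c * s + S k n) ⟩
  (1ℚ + ι k) * (c * s + S k n)
    ≡⟨ cong₂ _*_ (sym (ι-suc k)) (sym (D-S k n)) ⟩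
  c * S (suc k) (suc n)
    ∎
  where
  open ≡-Reasoning
  a c s : ℚ
  a = (E ⋆ S k) n
  c = ι (suc k)
  s = S (suc k) n
  collect : ∀ k p → p + k * p ≡ (1ℚ + k) * p
  collect = solve-∀ ℚ-ring
  D-E-⋆ : (D E ⋆ S k) n ≡ a + S k n
  D-E-⋆ = trans (⋆-congʳ (S k) {D E} {E ⊕ δ} (λ i → sym (trans (E⊕δ i) (exp-1 i))) n)
    (trans (⋆-distribʳ-⊕ (S k) E δ n) (cong (λ z → a + z) (⋆-identityˡ (S k) n)))
  E-⋆-D : ∀ k → (E ⋆ D (S k)) n ≡ ι k * ((E ⋆ S k) n + S k n)
  E-⋆-D zero    = trans (⋆-comm E (D (S 0)) n) (trans (⋆-zeroˡ E n) (sym (ℚₚ.*-zeroˡ ((E ⋆ S 0) n + S 0 n))))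
  E-⋆-D (suc j) = begin
    (E ⋆ D (S (suc j))) n
      ≡⟨ ⋆-congˡ E (D-S j) n ⟩
    (E ⋆ (ι (suc j) · S (suc j) ⊕ S j)) n
      ≡⟨ ⋆-distribˡ-⊕ E (ι (suc j) · S (suc j)) (S j) n ⟩
    (E ⋆ (ι (suc j) · S (suc j))) n + (E ⋆ S j) n
      ≡⟨ cong₂ _+_ (⋆-·-comm (ι (suc j)) E (S (suc j)) n) (E-⋆-S j n) ⟩
    ι (suc j) * (E ⋆ S (suc j)) n + ι (suc j) * S (suc j) n
      ≡⟨ ℚₚ.*-distribˡ-+ (ι (suc j)) ((E ⋆ S (suc j)) n) (S (suc j) n) ⟨
    ι (suc j) * ((E ⋆ S (suc j)) n + S (suc j) n)
      ∎

ℬ-⋆ : ∀ n k → ℬ n k ≡ (scale (ι k) bernoulli ⋆ S k) n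
ℬ-⋆ n k = trans (sum-cong n term) (sym (⋆-binomial n (scale (ι k) bernoulli) (S k)))
  where
  open ≡-Reasoning
  shuffle : ∀ b c s e → b * ((c * s) * e) ≡ c * ((e * b) * s)
  shuffle = solve-∀ ℚ-ring
  term : ∀ h → bernoulli h * ι ((n C h) ℕ.* stirling2 (n ∸ h) k ℕ.* k ℕ.^ h)
             ≡ ι (n C h) * (scale (ι k) bernoulli h * S k (n ∸ h))
  term h = begin
    bernoulli h * ι ((n C h) ℕ.* stirling2 (n ∸ h) k ℕ.* k ℕ.^ h)
      ≡⟨ cong (bernoulli h *_) (trans (ι-* ((n C h) ℕ.* stirling2 (n ∸ h) k) (k ℕ.^ h))
           (cong₂ _*_ (ι-* (n C h) (stirling2 (n ∸ h) k)) (sym (exp-ι k h)))) ⟩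
    bernoulli h * (ι (n C h) * S k (n ∸ h) * exp (ι k) h)
      ≡⟨ shuffle (bernoulli h) (ι (n C h)) (S k (n ∸ h)) (exp (ι k) h) ⟩
    ι (n C h) * (scale (ι k) bernoulli h * S k (n ∸ h))
      ∎

reflect : Seq → Seq
reflect = scale (- 1ℚ)

exp1-⋆-reflect-E : exp 1ℚ ⋆ reflect E ≗ (- 1ℚ) · E
exp1-⋆-reflect-E n = begin
  p                                         ≡⟨ split p (E n) (δ n) ⟩
  (p + (E n + δ n)) + ((- 1ℚ) * E n - δ n)  ≡⟨ cong (_+ ((- 1ℚ) * E n - δ n)) total ⟩
  δ n + ((- 1ℚ) * E n - δ n)                ≡⟨ drop (δ n) ((- 1ℚ) * E n) ⟩
  (- 1ℚ) * E n                              ∎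
  where
  open ≡-Reasoning
  p = (exp 1ℚ ⋆ reflect E) n
  split : ∀ p e d → p ≡ (p + (e + d)) + ((- 1ℚ) * e - d)
  split = solve-∀ ℚ-ring
  drop : ∀ d e → d + (e - d) ≡ e
  drop = solve-∀ ℚ-ring
  reflect-E⊕δ : reflect E ⊕ δ ≗ exp (- 1ℚ)
  reflect-E⊕δ zero    = refl
  reflect-E⊕δ (suc n) = trans (ℚₚ.+-identityʳ _) (ℚₚ.*-identityʳ (exp (- 1ℚ) (suc n)))
  total : p + (E n + δ n) ≡ δ n
  total = begin
    p + (E n + δ n)                 ≡⟨ cong (λ z → p + z) (trans (E⊕δ n) (sym (trans (⋆-comm (exp 1ℚ) δ n) (⋆-identityˡ (exp 1ℚ) n)))) ⟩
    p + (exp 1ℚ ⋆ δ) n              ≡⟨ ⋆-distribˡ-⊕ (exp 1ℚ) (reflect E) δ n ⟨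
    (exp 1ℚ ⋆ (reflect E ⊕ δ)) n    ≡⟨ ⋆-congˡ (exp 1ℚ) reflect-E⊕δ n ⟩
    (exp 1ℚ ⋆ exp (- 1ℚ)) n         ≡⟨ exp-⋆ 1ℚ (- 1ℚ) n ⟩
    exp 0ℚ n                        ≡⟨ exp-0 n ⟩
    δ n                             ∎

reflect-bernoulli : reflect bernoulli ≗ exp 1ℚ ⋆ bernoulli
reflect-bernoulli = E-cancel (begin
  b̄ ⋆ E                                  ≈⟨ (λ n → neg-neg ((b̄ ⋆ E) n)) ⟩
  -1' · (-1' · (b̄ ⋆ E))                   ≈⟨ (λ n → cong (-1' *_) (⋆-·-comm -1' b̄ E n)) ⟨
  -1' · (b̄ ⋆ (-1' · E))                   ≈⟨ (λ n → cong (-1' *_) (⋆-congˡ b̄ exp1-⋆-reflect-E n)) ⟨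
  -1' · (b̄ ⋆ (exp 1ℚ ⋆ reflect E))        ≈⟨ (λ n → cong (-1' *_) (left-comm b̄ (exp 1ℚ) (reflect E) n)) ⟩
  -1' · (exp 1ℚ ⋆ (b̄ ⋆ reflect E))        ≈⟨ (λ n → cong (-1' *_) (⋆-congˡ (exp 1ℚ) b̄⋆ n)) ⟩
  -1' · (exp 1ℚ ⋆ (-1' · y))              ≈⟨ (λ n → cong (-1' *_) (⋆-·-comm -1' (exp 1ℚ) y n)) ⟩
  -1' · (-1' · (exp 1ℚ ⋆ y))              ≈⟨ (λ n → neg-neg ((exp 1ℚ ⋆ y) n)) ⟨
  exp 1ℚ ⋆ y                              ≈⟨ ⋆-congˡ (exp 1ℚ) bernoulli-⋆-E ⟨
  exp 1ℚ ⋆ (bernoulli ⋆ E)                ≈⟨ ⋆-assoc (exp 1ℚ) bernoulli E ⟨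
  exp 1ℚ ⋆ bernoulli ⋆ E                  ∎)
  where
  open ≗-Reasoning
  -1' = - 1ℚ
  b̄ = reflect bernoulli
  neg-neg : ∀ q → q ≡ - 1ℚ * (- 1ℚ * q)
  neg-neg = solve-∀ ℚ-ring
  left-comm : ∀ f g h → f ⋆ (g ⋆ h) ≗ g ⋆ (f ⋆ h)
  left-comm f g h = ≗-trans (≗-sym (⋆-assoc f g h))
    (≗-trans (⋆-congʳ h (⋆-comm f g)) (⋆-assoc g f h))
  b̄⋆ : b̄ ⋆ reflect E ≗ -1' · y
  b̄⋆ = ≗-trans (≗-sym (scale-⋆ -1' bernoulli E))
    (≗-trans (λ n → cong (exp -1' n *_) (bernoulli-⋆-E n)) (scale-y -1'))

exp-⋆-reflect-S : ∀ k → exp (ι k) ⋆ reflect (S k) ≗ exp (- 1ℚ) k · S k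
exp-⋆-reflect-S zero = begin
  exp 0ℚ ⋆ reflect (S 0)   ≈⟨ ⋆-congʳ (reflect (S 0)) exp-0 ⟩
  δ ⋆ reflect (S 0)        ≈⟨ ⋆-identityˡ (reflect (S 0)) ⟩
  reflect (S 0)            ≈⟨ reflect-S₀ ⟩
  1ℚ · S 0                 ∎
  where
  open ≗-Reasoning
  reflect-S₀ : reflect (S 0) ≗ 1ℚ · S 0
  reflect-S₀ zero    = refl
  reflect-S₀ (suc n) = ℚₚ.*-zeroʳ (exp (- 1ℚ) (suc n))
exp-⋆-reflect-S (suc j) n = ι-cancelˡ j (eq n)
  where
  open ≗-Reasoning
  k = ι (suc j)
  eq : k · (exp k ⋆ reflect (S (suc j))) ≗ k · (exp (- 1ℚ) (suc j) · S (suc j))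
  eq = begin
    k · (exp k ⋆ reflect (S (suc j)))
      ≈⟨ ⋆-·-comm k (exp k) (reflect (S (suc j))) ⟨
    exp k ⋆ (k · reflect (S (suc j)))
      ≈⟨ ⋆-congˡ (exp k) (λ n → *-left-comm (exp (- 1ℚ) n) k (S (suc j) n)) ⟨
    exp k ⋆ reflect (k · S (suc j))
      ≈⟨ ⋆-congˡ (exp k) (λ n → cong (exp (- 1ℚ) n *_) (E-⋆-S j n)) ⟨
    exp k ⋆ reflect (E ⋆ S j)
      -- e^{(j+1)y} is split as e^y e^{jy}: the first factor goes to `reflect E`, the second to
      -- `reflect (S j)`.
      ≈⟨ ⋆-cong (λ n → trans (cong (λ c → exp c n) (ι-suc j)) (sym (exp-⋆ 1ℚ (ι j) n))) (scale-⋆ (- 1ℚ) E (S j)) ⟩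
    (exp 1ℚ ⋆ exp (ι j)) ⋆ (reflect E ⋆ reflect (S j))
      ≈⟨ ⋆-interchange (exp 1ℚ) (exp (ι j)) (reflect E) (reflect (S j)) ⟩
    (exp 1ℚ ⋆ reflect E) ⋆ (exp (ι j) ⋆ reflect (S j))
      ≈⟨ ⋆-cong exp1-⋆-reflect-E (exp-⋆-reflect-S j) ⟩
    ((- 1ℚ) · E) ⋆ (exp (- 1ℚ) j · S j)
      ≈⟨ ≗-trans (·-⋆-assoc (- 1ℚ) E (exp (- 1ℚ) j · S j)) (λ n → cong (- 1ℚ *_) (⋆-·-comm (exp (- 1ℚ) j) E (S j) n)) ⟩
    (- 1ℚ) · (exp (- 1ℚ) j · (E ⋆ S j))
      ≈⟨ (λ n → cong (λ z → - 1ℚ * (exp (- 1ℚ) j * z)) (E-⋆-S j n)) ⟩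
    (- 1ℚ) · (exp (- 1ℚ) j · (k · S (suc j)))
      ≈⟨ (λ n → pull (- 1ℚ) (exp (- 1ℚ) j) k (S (suc j) n)) ⟩
    k · (exp (- 1ℚ) (suc j) · S (suc j))
      ∎
    where
    pull : ∀ a b c d → a * (b * (c * d)) ≡ c * ((a * b) * d)
    pull = solve-∀ ℚ-ring

ℬ-reflect : ∀ n k → exp (- 1ℚ) n * ℬ n k ≡ exp (- 1ℚ) k * ℬ n k
ℬ-reflect n k = trans (cong (exp (- 1ℚ) n *_) (ℬ-⋆ n k)) (trans (eq n) (cong (exp (- 1ℚ) k *_) (sym (ℬ-⋆ n k))))
  where
  open ≗-Reasoning
  σ = scale (ι k)
  eq : reflect (σ bernoulli ⋆ S k) ≗ exp (- 1ℚ) k · (σ bernoulli ⋆ S k)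
  eq = begin
    reflect (σ bernoulli ⋆ S k)
      ≈⟨ scale-⋆ (- 1ℚ) (σ bernoulli) (S k) ⟩
    reflect (σ bernoulli) ⋆ reflect (S k)
      ≈⟨ ⋆-congʳ (reflect (S k)) (scale-comm (- 1ℚ) (ι k) bernoulli) ⟩
    σ (reflect bernoulli) ⋆ reflect (S k)
      ≈⟨ ⋆-congʳ (reflect (S k)) (λ n → cong (exp (ι k) n *_) (reflect-bernoulli n)) ⟩
    σ (exp 1ℚ ⋆ bernoulli) ⋆ reflect (S k)
      ≈⟨ ⋆-congʳ (reflect (S k)) (scale-⋆ (ι k) (exp 1ℚ) bernoulli) ⟩
    (σ (exp 1ℚ) ⋆ σ bernoulli) ⋆ reflect (S k)
      ≈⟨ ⋆-congʳ (reflect (S k)) (⋆-congʳ (σ bernoulli) (λ n → trans (cong (exp (ι k) n *_) (exp-1 n)) (ℚₚ.*-identityʳ (exp (ι k) n)))) ⟩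
    (exp (ι k) ⋆ σ bernoulli) ⋆ reflect (S k)
      ≈⟨ ⋆-congʳ (reflect (S k)) (⋆-comm (exp (ι k)) (σ bernoulli)) ⟩
    (σ bernoulli ⋆ exp (ι k)) ⋆ reflect (S k)
      ≈⟨ ⋆-assoc (σ bernoulli) (exp (ι k)) (reflect (S k)) ⟩
    σ bernoulli ⋆ (exp (ι k) ⋆ reflect (S k))
      ≈⟨ ⋆-congˡ (σ bernoulli) (exp-⋆-reflect-S k) ⟩
    σ bernoulli ⋆ (exp (- 1ℚ) k · S k)
      ≈⟨ ⋆-·-comm (exp (- 1ℚ) k) (σ bernoulli) (S k) ⟩
    exp (- 1ℚ) k · (σ bernoulli ⋆ S k)
      ∎

exp-+ : ∀ a m n → exp a (m ℕ.+ n) ≡ exp a m * exp a n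
exp-+ a zero    n = sym (ℚₚ.*-identityˡ (exp a n))
exp-+ a (suc m) n = trans (cong (a *_) (exp-+ a m n)) (sym (ℚₚ.*-assoc a (exp a m) (exp a n)))

sign-* : ∀ n → exp (- 1ℚ) n * exp (- 1ℚ) n ≡ 1ℚ
sign-* zero    = refl
sign-* (suc n) = trans (square (exp (- 1ℚ) n)) (sign-* n)
  where
  square : ∀ s → (- 1ℚ * s) * (- 1ℚ * s) ≡ s * s
  square = solve-∀ ℚ-ring

sign-odd : ∀ m → exp (- 1ℚ) (suc (m ℕ.+ m)) ≡ - 1ℚ
sign-odd m = cong (- 1ℚ *_) (trans (exp-+ (- 1ℚ) m m) (sign-* m))

p≡-p⇒p≡0 : ∀ p → p ≡ - p → p ≡ 0ℚ
p≡-p⇒p≡0 p p≡-p = ι-cancelˡ 1 (trans (double p) (trans (cong (λ z → p + z) p≡-p) (trans (ℚₚ.+-inverseʳ p) (sym (ℚₚ.*-zeroʳ (ι 2))))))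
  where
  double : ∀ p → (1ℚ + 1ℚ) * p ≡ p + p
  double = solve-∀ ℚ-ring

ℬ-odd : ∀ n k → ∃[ m ] (+ n ℤ.- + k ≡ ℤ.1ℤ ℤ.+ + 2 ℤ.* m) → ℬ n k ≡ 0ℚ
ℬ-odd n k (m , eq) = p≡-p⇒p≡0 (ℬ n k) (cancel (opposite m eq))
  where
  q = ℬ n k
  s : ℕ → ℚ
  s = exp (- 1ℚ)
  solve-n : ∀ n k m → n ℤ.- k ≡ ℤ.1ℤ ℤ.+ + 2 ℤ.* m → n ≡ ℤ.1ℤ ℤ.+ (m ℤ.+ m) ℤ.+ k
  solve-n n k m eq = trans (l₁ n k) (trans (cong (ℤ._+ k) eq) (l₂ m k))
    where
    l₁ : ∀ n k → n ≡ (n ℤ.- k) ℤ.+ k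
    l₁ = ℤSolver.solve-∀
    l₂ : ∀ m k → ℤ.1ℤ ℤ.+ + 2 ℤ.* m ℤ.+ k ≡ ℤ.1ℤ ℤ.+ (m ℤ.+ m) ℤ.+ k
    l₂ = ℤSolver.solve-∀
  solve-k : ∀ n k m → n ℤ.- k ≡ ℤ.1ℤ ℤ.+ + 2 ℤ.* (ℤ.- (ℤ.1ℤ ℤ.+ m)) → k ≡ ℤ.1ℤ ℤ.+ (m ℤ.+ m) ℤ.+ n
  solve-k n k m eq = trans (l₁ n k) (trans (cong (λ z → n ℤ.- z) eq) (l₂ m n))
    where
    l₁ : ∀ n k → k ≡ n ℤ.- (n ℤ.- k)
    l₁ = ℤSolver.solve-∀
    l₂ : ∀ m n → n ℤ.- (ℤ.1ℤ ℤ.+ + 2 ℤ.* (ℤ.- (ℤ.1ℤ ℤ.+ m))) ≡ ℤ.1ℤ ℤ.+ (m ℤ.+ m) ℤ.+ n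
    l₂ = ℤSolver.solve-∀
  odd-apart : ∀ i {a b} → a ≡ suc (i ℕ.+ i) ℕ.+ b → s a ≡ - s b
  odd-apart i {a} {b} eq = trans (cong s eq) (trans (exp-+ (- 1ℚ) (suc (i ℕ.+ i)) b)
    (trans (cong (_* s b) (sign-odd i)) (neg (s b))))
    where
    neg : ∀ p → - 1ℚ * p ≡ - p
    neg = solve-∀ ℚ-ring
  opposite : ∀ m → + n ℤ.- + k ≡ ℤ.1ℤ ℤ.+ + 2 ℤ.* m → s n ≡ - s k
  opposite (+ i) eq = odd-apart i (ℤₚ.+-injective (solve-n (+ n) (+ k) (+ i) eq))
  -- For negative m it is k - n that equals 2i + 1 with i natural, so n and k exchange roles.
  opposite -[1+ i ] eq =
    trans (neg-neg (s n)) (cong -_ (sym (odd-apart i (ℤₚ.+-injective (solve-k (+ n) (+ k) (+ i) eq)))))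
    where
    neg-neg : ∀ p → p ≡ - (- p)
    neg-neg = solve-∀ ℚ-ring
  cancel : s n ≡ - s k → q ≡ - q
  cancel s-eq = begin
    q                       ≡⟨ ℚₚ.*-identityˡ q ⟨
    1ℚ * q                  ≡⟨ cong (_* q) (sign-* k) ⟨
    s k * s k * q           ≡⟨ ℚₚ.*-assoc (s k) (s k) q ⟩
    s k * (s k * q)         ≡⟨ cong (s k *_) (ℬ-reflect n k) ⟨
    s k * (s n * q)         ≡⟨ cong (λ t → s k * (t * q)) s-eq ⟩
    s k * (- s k * q)       ≡⟨ pull (s k) q ⟩
    - (s k * s k * q)       ≡⟨ cong (λ t → - (t * q)) (sign-* k) ⟩
    - (1ℚ * q)              ≡⟨ cong -_ (ℚₚ.*-identityˡ q) ⟩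
    - q                     ∎
    where
    open ≡-Reasoning
    pull : ∀ a q → a * (- a * q) ≡ - (a * a * q)
    pull = solve-∀ ℚ-ring

-- Integrality

-- The series Σ_{l<k} e^{ly}, that is (e^{ky} - 1)/(e^y - 1); its coefficients are the power sums
-- Σ_{l<k} l^n with 0^0 = 1.
powerSums : ℕ → Seq
powerSums zero    = 𝟘
powerSums (suc k) = powerSums k ⊕ exp (ι k)

powerSums-0 : ∀ k → powerSums k 0 ≡ ι k
powerSums-0 zero    = refl
powerSums-0 (suc k) = trans (cong (_+ 1ℚ) (powerSums-0 k)) (trans (ℚₚ.+-comm (ι k) 1ℚ) (sym (ι-suc k)))

-- The geometric sum telescopes; the 1 stands on the left so that the induction needs no
-- subtraction.
E-⋆-powerSums : ∀ k → E ⋆ powerSums k ⊕ δ ≗ exp (ι k)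
E-⋆-powerSums zero n = begin
  (E ⋆ 𝟘) n + δ n  ≡⟨ cong (_+ δ n) (trans (⋆-comm E 𝟘 n) (⋆-zeroˡ E n)) ⟩
  0ℚ + δ n         ≡⟨ ℚₚ.+-identityˡ (δ n) ⟩
  δ n              ≡⟨ exp-0 n ⟨
  exp 0ℚ n         ∎
  where open ≡-Reasoning
E-⋆-powerSums (suc k) n = begin
  (E ⋆ (powerSums k ⊕ e)) n + δ n               ≡⟨ cong (_+ δ n) (⋆-distribˡ-⊕ E (powerSums k) e n) ⟩
  (E ⋆ powerSums k) n + (E ⋆ e) n + δ n         ≡⟨ swap ((E ⋆ powerSums k) n) ((E ⋆ e) n) (δ n) ⟩
  (E ⋆ e) n + ((E ⋆ powerSums k) n + δ n)       ≡⟨ cong (λ z → (E ⋆ e) n + z) (trans (E-⋆-powerSums k n) (sym (⋆-identityˡ e n))) ⟩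
  (E ⋆ e) n + (δ ⋆ e) n                         ≡⟨ ⋆-distribʳ-⊕ e E δ n ⟨
  ((E ⊕ δ) ⋆ e) n                               ≡⟨ ⋆-congʳ e E⊕δ n ⟩
  (exp 1ℚ ⋆ e) n                                ≡⟨ exp-⋆ 1ℚ (ι k) n ⟩
  exp (1ℚ + ι k) n                              ≡⟨ cong (λ c → exp c n) (ι-suc k) ⟨
  exp (ι (suc k)) n                             ∎
  where
  open ≡-Reasoning
  e = exp (ι k)
  swap : ∀ a b c → a + b + c ≡ b + (a + c)
  swap = solve-∀ ℚ-ring

powerSums-⋆-E : ∀ k → powerSums k ⋆ E ≗ scale (ι k) E
powerSums-⋆-E k n = trans (⋆-comm (powerSums k) E n)
  (∙-cancelʳ ℚₚ.+-0-group (δ n) _ _ (trans (E-⋆-powerSums k n) (sym (scale-E⊕δ n))))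
  where
  scale-E⊕δ : scale (ι k) E ⊕ δ ≗ exp (ι k)
  scale-E⊕δ zero    = refl
  scale-E⊕δ (suc n) = trans (ℚₚ.+-identityʳ _) (ℚₚ.*-identityʳ (exp (ι k) (suc n)))

-- (k y/(e^{ky} - 1)) · (e^{ky} - 1)/(e^y - 1) = k y/(e^y - 1). This identity serves twice: to bound
-- the denominators of k^h B_h and to remove the pole in ℬ.
scale-bernoulli-⋆-powerSums : ∀ k → scale (ι k) bernoulli ⋆ powerSums k ≗ ι k · bernoulli
scale-bernoulli-⋆-powerSums k = E-cancel (begin
  σ bernoulli ⋆ powerSums k ⋆ E     ≈⟨ ⋆-assoc (σ bernoulli) (powerSums k) E ⟩
  σ bernoulli ⋆ (powerSums k ⋆ E)   ≈⟨ ⋆-congˡ (σ bernoulli) (powerSums-⋆-E k) ⟩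
  σ bernoulli ⋆ σ E                 ≈⟨ scale-⋆ (ι k) bernoulli E ⟨
  σ (bernoulli ⋆ E)                 ≈⟨ (λ n → cong (exp (ι k) n *_) (bernoulli-⋆-E n)) ⟩
  σ y                               ≈⟨ scale-y (ι k) ⟩
  ι k · y                           ≈⟨ (λ n → cong (ι k *_) (bernoulli-⋆-E n)) ⟨
  ι k · (bernoulli ⋆ E)             ≈⟨ ·-⋆-assoc (ι k) bernoulli E ⟨
  (ι k · bernoulli) ⋆ E             ∎)
  where
  open ≗-Reasoning
  σ = scale (ι k)

IsInt : ℚ → Set
IsInt q = ∃[ z ] q ≡ toℚ z

ι-int : ∀ n → IsInt (ι n)
ι-int n = + n , refl

int-+ : ∀ {p q} → IsInt p → IsInt q → IsInt (p + q)
int-+ (a , refl) (b , refl) = a ℤ.+ b , sym (toℚ-+ a b)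

int-* : ∀ {p q} → IsInt p → IsInt q → IsInt (p * q)
int-* (a , refl) (b , refl) = a ℤ.* b , sym (toℚ-* a b)

int-neg : ∀ {p} → IsInt p → IsInt (- p)
int-neg (a , refl) = ℤ.- a , sym (toℚ-neg a)

int-minus : ∀ {p q} → IsInt p → IsInt q → IsInt (p - q)
int-minus p q = int-+ p (int-neg q)

int-exp : ∀ {a} → IsInt a → ∀ n → IsInt (exp a n)
int-exp a zero    = ι-int 1
int-exp a (suc n) = int-* a (int-exp a n)

int-⋆ : ∀ {f g} → (∀ i → IsInt (f i)) → (∀ i → IsInt (g i)) → ∀ n → IsInt ((f ⋆ g) n)
int-⋆ f g zero    = int-* (f 0) (g 0)
int-⋆ f g (suc n) = int-+ (int-⋆ (λ i → f (suc i)) g n) (int-⋆ f (λ i → g (suc i)) n)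

int-powerSums : ∀ k n → IsInt (powerSums k n)
int-powerSums zero    n = ι-int 0
int-powerSums (suc k) n = int-+ (int-powerSums k n) (int-exp (ι-int k) n)

-- Membership in the localisation of ℤ at 1 + kℤ, i.e. the denominator of q is coprime to k.
CoprimeDenom : ℕ → ℚ → Set
CoprimeDenom k q = ∃[ a ] IsInt a × IsInt ((1ℚ - ι k * a) * q)

int⇒cop : ∀ k {q} → IsInt q → CoprimeDenom k q
int⇒cop k {q} q∈ℤ = 0ℚ , ι-int 0 , subst IsInt (unit (ι k) q) q∈ℤ
  where
  unit : ∀ k q → q ≡ (1ℚ - k * 0ℚ) * q
  unit = solve-∀ ℚ-ring

int-denom : ∀ k {a} → IsInt a → IsInt (1ℚ - ι k * a)
int-denom k a∈ℤ = int-minus (ι-int 1) (int-* (ι-int k) a∈ℤ)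

-- Since (1 - k a)(1 - k b) = 1 - k (a + b - k a b), denominators of the form 1 - k a are closed
-- under products; this integer is the witness in `cop-+` and `cop-divide`.
int-common : ∀ k {a b} → IsInt a → IsInt b → IsInt (a + b - ι k * (a * b))
int-common k a∈ℤ b∈ℤ = int-minus (int-+ a∈ℤ b∈ℤ) (int-* (ι-int k) (int-* a∈ℤ b∈ℤ))

cop-+ : ∀ k {p q} → CoprimeDenom k p → CoprimeDenom k q → CoprimeDenom k (p + q)
cop-+ k {p} {q} (a , a∈ℤ , ap∈ℤ) (b , b∈ℤ , bq∈ℤ) =
  a + b - ι k * (a * b) , int-common k a∈ℤ b∈ℤ ,
  subst IsInt (expand (ι k) a b p q)
    (int-+ (int-* (int-denom k b∈ℤ) ap∈ℤ) (int-* (int-denom k a∈ℤ) bq∈ℤ))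
  where
  expand : ∀ k a b p q → (1ℚ - k * b) * ((1ℚ - k * a) * p) + (1ℚ - k * a) * ((1ℚ - k * b) * q)
                       ≡ (1ℚ - k * (a + b - k * (a * b))) * (p + q)
  expand = solve-∀ ℚ-ring

cop-*ˡ : ∀ k {c q} → IsInt c → CoprimeDenom k q → CoprimeDenom k (c * q)
cop-*ˡ k {c} {q} c∈ℤ (a , a∈ℤ , aq∈ℤ) = a , a∈ℤ , subst IsInt (*-left-comm c (1ℚ - ι k * a) q) (int-* c∈ℤ aq∈ℤ)

cop-divide : ∀ k {b q} → IsInt b → CoprimeDenom k ((1ℚ - ι k * b) * q) → CoprimeDenom k q
cop-divide k {b} {q} b∈ℤ (a , a∈ℤ , abq∈ℤ) =
  a + b - ι k * (a * b) , int-common k a∈ℤ b∈ℤ , subst IsInt (expand (ι k) a b q) abq∈ℤ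
  where
  expand : ∀ k a b q → (1ℚ - k * a) * ((1ℚ - k * b) * q) ≡ (1ℚ - k * (a + b - k * (a * b))) * q
  expand = solve-∀ ℚ-ring

cop-sum : ∀ k n {f : ℕ → ℚ} → (∀ i → i ≤ n → CoprimeDenom k (f i)) → CoprimeDenom k (sumℚ n f)
cop-sum k zero    f = f 0 z≤n
cop-sum k (suc n) f = cop-+ k (cop-sum k n (λ i i≤n → f i (ℕₚ.m≤n⇒m≤1+n i≤n))) (f (suc n) ℕₚ.≤-refl)

⋆-last : ∀ n f g → (f ⋆ g) (suc n)
  ≡ sumℚ n (λ h → ι (suc n C h) * (f h * g (suc n ∸ h))) + f (suc n) * g 0
⋆-last n f g = trans (⋆-binomial (suc n) f g)
  (cong (λ z → sumℚ n (λ h → ι (suc n C h) * (f h * g (suc n ∸ h))) + z)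
    (trans (cong₂ (λ c i → ι c * (f (suc n) * g i)) (nCn≡1 (suc n)) (ℕₚ.n∸n≡0 n))
           (ℚₚ.*-identityˡ (f (suc n) * g 0))))

-- Comparing the coefficients of yⁿ in (k y/(e^{ky} − 1)) Σ_{l<k} e^{ly} = k y/(e^y − 1) expresses
-- k (1 − kⁿ) Bₙ through the kʰ B_h with h < n, and 1 − kⁿ is coprime to k.
cop-bernoulli : ∀ k n → CoprimeDenom k (scale (ι k) bernoulli n)
cop-bernoulli k = <-rec (λ n → CoprimeDenom k (c n)) step
  where
  c : Seq
  c = scale (ι k) bernoulli
  step : ∀ n → (∀ {h} → h < n → CoprimeDenom k (c h)) → CoprimeDenom k (c n)
  step zero    rec = int⇒cop k (ι-int 1)
  step (suc m) rec = cop-divide k (int-exp (ι-int k) m)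
    (subst (CoprimeDenom k) eq (cop-*ˡ k (int-exp (ι-int k) m) (cop-sum k m term)))
    where
    t : ℕ → ℚ
    t h = ι (suc m C h) * (c h * powerSums k (suc m ∸ h))
    term : ∀ h → h ≤ m → CoprimeDenom k (t h)
    term h h≤m = cop-*ˡ k (ι-int (suc m C h))
      (subst (CoprimeDenom k) (ℚₚ.*-comm (powerSums k (suc m ∸ h)) (c h))
        (cop-*ˡ k (int-powerSums k (suc m ∸ h)) (rec (s≤s h≤m))))
    -- The factor k^m turns k B_{m+1} on the right of `full` into `c (suc m)`, so that the relation
    -- involves values of `c` only.
    eq : exp (ι k) m * sumℚ m t ≡ (1ℚ - ι k * exp (ι k) m) * c (suc m)
    eq = begin
      x * sumℚ m t
        ≡⟨ expand x (sumℚ m t) κ (bernoulli (suc m)) ⟩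
      x * (sumℚ m t + (κ * x * bernoulli (suc m)) * κ) - κ * x * (κ * x * bernoulli (suc m))
        ≡⟨ cong (λ z → x * z - κ * x * c (suc m)) full ⟩
      x * (κ * bernoulli (suc m)) - κ * x * (κ * x * bernoulli (suc m))
        ≡⟨ factor x κ (bernoulli (suc m)) ⟩
      (1ℚ - κ * x) * (κ * x * bernoulli (suc m))
        ∎
      where
      open ≡-Reasoning
      x κ : ℚ
      x = exp (ι k) m
      κ = ι k
      expand : ∀ x s κ b → x * s ≡ x * (s + (κ * x * b) * κ) - κ * x * (κ * x * b)
      expand = solve-∀ ℚ-ring
      factor : ∀ x κ b → x * (κ * b) - κ * x * (κ * x * b) ≡ (1ℚ - κ * x) * (κ * x * b)
      factor = solve-∀ ℚ-ring
      full : sumℚ m t + c (suc m) * κ ≡ κ * bernoulli (suc m)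
      full = begin
        sumℚ m t + c (suc m) * κ                ≡⟨ cong (λ z → sumℚ m t + c (suc m) * z) (powerSums-0 k) ⟨
        sumℚ m t + c (suc m) * powerSums k 0    ≡⟨ ⋆-last m c (powerSums k) ⟨
        (c ⋆ powerSums k) (suc m)               ≡⟨ scale-bernoulli-⋆-powerSums k (suc m) ⟩
        κ * bernoulli (suc m)                   ∎

cop-⋆ : ∀ k {f g} → (∀ i → CoprimeDenom k (f i)) → (∀ i → IsInt (g i)) → ∀ n → CoprimeDenom k ((f ⋆ g) n)
cop-⋆ k {f} {g} f∈ g∈ℤ zero    = subst (CoprimeDenom k) (ℚₚ.*-comm (g 0) (f 0)) (cop-*ˡ k (g∈ℤ 0) (f∈ 0))
cop-⋆ k f∈ g∈ℤ (suc n) = cop-+ k (cop-⋆ k (λ i → f∈ (suc i)) g∈ℤ n) (cop-⋆ k f∈ (λ i → g∈ℤ (suc i)) n)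

int-sum : ∀ n {f : ℕ → ℚ} → (∀ i → i ≤ n → IsInt (f i)) → IsInt (sumℚ n f)
int-sum zero    f = f 0 z≤n
int-sum (suc n) f = int-+ (int-sum n (λ i i≤n → f i (ℕₚ.m≤n⇒m≤1+n i≤n))) (f (suc n) ℕₚ.≤-refl)

-- Solving the convolution for f n divides once by g 0 = k, and the earlier values f h carry at most
-- k^{h+1} in their denominators.
int-quotient : ∀ k {f g} → g 0 ≡ ι k → (∀ i → IsInt (g i)) → (∀ i → IsInt ((f ⋆ g) i)) →
  ∀ n → IsInt (exp (ι k) (suc n) * f n)
int-quotient k {f} {g} g₀≡k g∈ℤ fg∈ℤ = <-rec (λ n → IsInt (exp (ι k) (suc n) * f n)) step
  where
  swap : ∀ a b → a * b ≡ b * 1ℚ * a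
  swap = solve-∀ ℚ-ring
  step : ∀ n → (∀ {h} → h < n → IsInt (exp (ι k) (suc h) * f h)) → IsInt (exp (ι k) (suc n) * f n)
  step zero    rec = subst IsInt (trans (cong (f 0 *_) g₀≡k) (swap (f 0) (ι k))) (fg∈ℤ 0)
  step (suc m) rec = subst IsInt eq
    (int-minus (int-* (int-exp (ι-int k) (suc m)) (fg∈ℤ (suc m))) (int-sum m term))
    where
    x : ℚ
    x = exp (ι k) (suc m)
    t : ℕ → ℚ
    t h = ι (suc m C h) * (f h * g (suc m ∸ h))
    term : ∀ h → h ≤ m → IsInt (x * t h)
    term h h≤m = subst IsInt regroup
      (int-* (int-* (int-* (int-exp (ι-int k) (m ∸ h)) (rec (s≤s h≤m))) (ι-int (suc m C h))) (g∈ℤ (suc m ∸ h)))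
      where
      shuffle : ∀ a b f c g → a * (b * f) * c * g ≡ (a * b) * (c * (f * g))
      shuffle = solve-∀ ℚ-ring
      regroup : exp (ι k) (m ∸ h) * (exp (ι k) (suc h) * f h) * ι (suc m C h) * g (suc m ∸ h) ≡ x * t h
      regroup = trans (shuffle (exp (ι k) (m ∸ h)) (exp (ι k) (suc h)) (f h) (ι (suc m C h)) (g (suc m ∸ h)))
        (cong (_* t h) (trans (sym (exp-+ (ι k) (m ∸ h) (suc h)))
          (cong (exp (ι k)) (trans (ℕₚ.+-suc (m ∸ h) h) (cong suc (ℕₚ.m∸n+n≡m h≤m))))))
    eq : x * (f ⋆ g) (suc m) - sumℚ m (λ h → x * t h) ≡ exp (ι k) (suc (suc m)) * f (suc m)
    eq = begin
      x * (f ⋆ g) (suc m) - sumℚ m (λ h → x * t h)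
        ≡⟨ cong₂ (λ a b → x * a - b) (trans (⋆-last m f g) (cong (λ z → sumℚ m t + f (suc m) * z) g₀≡k)) (sum-*ˡ m x t) ⟩
      x * (sumℚ m t + f (suc m) * ι k) - x * sumℚ m t
        ≡⟨ simplify x (sumℚ m t) (f (suc m)) (ι k) ⟩
      ι k * x * f (suc m)
        ∎
      where
      open ≡-Reasoning
      simplify : ∀ x s f k → x * (s + f * k) - x * s ≡ k * x * f
      simplify = solve-∀ ℚ-ring

-- Bezout: 1 = (1 - k a) + a k. Multiplied by k^n q, the first summand is an integer by coprimality
-- and the second by assumption, which removes one power of k.
int-from-coprime : ∀ k {q} → CoprimeDenom k q → ∀ n → IsInt (exp (ι k) n * q) → IsInt q
int-from-coprime k {q} q∈ zero = subst IsInt (ℚₚ.*-identityˡ q)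
int-from-coprime k {q} q∈@(a , a∈ℤ , aq∈ℤ) (suc n) kq∈ℤ = int-from-coprime k q∈ n
  (subst IsInt (combine (exp (ι k) n) (ι k) a q)
    (int-+ (int-* (int-exp (ι-int k) n) aq∈ℤ) (int-* a∈ℤ kq∈ℤ)))
  where
  combine : ∀ x k a q → x * ((1ℚ - k * a) * q) + a * (k * x * q) ≡ x * q
  combine = solve-∀ ℚ-ring

int-scale-bernoulli-⋆-S-⋆-powerSums : ∀ k n → IsInt ((scale (ι k) bernoulli ⋆ S k ⋆ powerSums k) n)
int-scale-bernoulli-⋆-S-⋆-powerSums k n = subst IsInt (sym (eq k n)) (rhs k n)
  where
  open ≗-Reasoning
  -- The scalar k is left on `S k`, where for k = j + 1 it is absorbed by reading `E-⋆-S` backwards;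
  -- then `bernoulli ⋆ E` collapses to y.
  eq : ∀ k → scale (ι k) bernoulli ⋆ S k ⋆ powerSums k ≗ bernoulli ⋆ (ι k · S k)
  eq k = begin
    scale (ι k) bernoulli ⋆ S k ⋆ powerSums k    ≈⟨ ⋆-swap (scale (ι k) bernoulli) (S k) (powerSums k) ⟩
    scale (ι k) bernoulli ⋆ powerSums k ⋆ S k    ≈⟨ ⋆-congʳ (S k) (scale-bernoulli-⋆-powerSums k) ⟩
    (ι k · bernoulli) ⋆ S k                      ≈⟨ ·-⋆-assoc (ι k) bernoulli (S k) ⟩
    ι k · (bernoulli ⋆ S k)                      ≈⟨ ⋆-·-comm (ι k) bernoulli (S k) ⟨
    bernoulli ⋆ (ι k · S k)                      ∎
  int-y : ∀ n → IsInt (y n)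
  int-y zero          = ι-int 0
  int-y (suc zero)    = ι-int 1
  int-y (suc (suc n)) = ι-int 0
  rhs : ∀ k n → IsInt ((bernoulli ⋆ (ι k · S k)) n)
  rhs zero    n = subst IsInt (sym (trans (⋆-·-comm (ι 0) bernoulli (S 0) n) (ℚₚ.*-zeroˡ ((bernoulli ⋆ S 0) n)))) (ι-int 0)
  rhs (suc j) n = subst IsInt (sym (eq′ n)) (int-⋆ int-y (λ i → ι-int (stirling2 i j)) n)
    where
    eq′ : bernoulli ⋆ (ι (suc j) · S (suc j)) ≗ y ⋆ S j
    eq′ = begin
      bernoulli ⋆ (ι (suc j) · S (suc j))  ≈⟨ ⋆-congˡ bernoulli (E-⋆-S j) ⟨
      bernoulli ⋆ (E ⋆ S j)                ≈⟨ ⋆-assoc bernoulli E (S j) ⟨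
      bernoulli ⋆ E ⋆ S j                  ≈⟨ ⋆-congʳ (S j) bernoulli-⋆-E ⟩
      y ⋆ S j                              ∎

ℬ-int : ∀ n k → ∃[ z ] ℬ n k ≡ toℚ z
ℬ-int n k = subst IsInt (sym (ℬ-⋆ n k)) (int-from-coprime k
  (cop-⋆ k (cop-bernoulli k) (λ i → ι-int (stirling2 i k)) n)
  (suc n)
  (int-quotient k (powerSums-0 k) (int-powerSums k) (int-scale-bernoulli-⋆-S-⋆-powerSums k) n))

-- Polynomials

-- Degree at most d, in Horner form. Agreement is only pointwise, so a function given by any formula
-- can be shown to be a polynomial.
Poly : ℕ → (ℚ → ℚ) → Set
Poly zero    f = ∃[ c ] (∀ t → f t ≡ c)
Poly (suc d) f = ∃[ c ] ∃[ g ] Poly d g × (∀ t → f t ≡ c + t * g t)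

poly-ext : ∀ d {f g} → (∀ t → f t ≡ g t) → Poly d g → Poly d f
poly-ext zero    f≗g (c , g≗)         = c , λ t → trans (f≗g t) (g≗ t)
poly-ext (suc d) f≗g (c , g′ , p , g≗) = c , g′ , p , λ t → trans (f≗g t) (g≗ t)

poly-+ : ∀ d {f g} → Poly d f → Poly d g → Poly d (λ t → f t + g t)
poly-+ zero    (a , f≗) (b , g≗) = a + b , λ t → cong₂ _+_ (f≗ t) (g≗ t)
poly-+ (suc d) (a , f′ , p , f≗) (b , g′ , q , g≗) =
  a + b , (λ t → f′ t + g′ t) , poly-+ d p q , λ t → trans (cong₂ _+_ (f≗ t) (g≗ t)) (collect a b t (f′ t) (g′ t))
  where
  collect : ∀ a b t p q → (a + t * p) + (b + t * q) ≡ (a + b) + t * (p + q)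
  collect = solve-∀ ℚ-ring

poly-*ˡ : ∀ d c {f} → Poly d f → Poly d (λ t → c * f t)
poly-*ˡ zero    c (a , f≗)          = c * a , λ t → cong (c *_) (f≗ t)
poly-*ˡ (suc d) c (a , f′ , p , f≗) =
  c * a , (λ t → c * f′ t) , poly-*ˡ d c p , λ t → trans (cong (c *_) (f≗ t)) (expand c a t (f′ t))
  where
  expand : ∀ c a t p → c * (a + t * p) ≡ c * a + t * (c * p)
  expand = solve-∀ ℚ-ring

poly-const : ∀ d c → Poly d (λ _ → c)
poly-const zero    c = c , λ _ → refl
poly-const (suc d) c = c , (λ _ → 0ℚ) , poly-const d 0ℚ , λ t → pad c t
  where
  pad : ∀ c t → c ≡ c + t * 0ℚ
  pad = solve-∀ ℚ-ring

poly-weaken : ∀ d {f} → Poly d f → Poly (suc d) f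
poly-weaken zero    (c , f≗)         = poly-ext 1 f≗ (poly-const 1 c)
poly-weaken (suc d) (c , g , p , f≗) = c , g , poly-weaken d p , f≗

poly-weaken-≤ : ∀ {d e f} → d ≤ e → Poly d f → Poly e f
poly-weaken-≤ {d} {e} {f} d≤e p = subst (λ i → Poly i f) (ℕₚ.m∸n+n≡m d≤e) (weaken (e ∸ d))
  where
  weaken : ∀ i → Poly (i ℕ.+ d) f
  weaken zero    = p
  weaken (suc i) = poly-weaken (i ℕ.+ d) (weaken i)

poly-linear : ∀ d a b {f} → Poly d f → Poly (suc d) (λ t → (a + b * t) * f t)
poly-linear d a b {f} p = poly-ext (suc d) (λ t → split a b t (f t))
  (poly-+ (suc d) (poly-weaken d (poly-*ˡ d a p)) (0ℚ , (λ t → b * f t) , poly-*ˡ d b p , λ _ → refl))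
  where
  split : ∀ a b t p → (a + b * t) * p ≡ a * p + (0ℚ + t * (b * p))
  split = solve-∀ ℚ-ring

poly-affine : ∀ d a b {f} → Poly d f → Poly d (λ t → f (a + b * t))
poly-affine zero    a b (c , f≗)         = c , λ t → f≗ (a + b * t)
poly-affine (suc d) a b (c , g , p , f≗) = poly-ext (suc d) (λ t → f≗ (a + b * t))
  (poly-+ (suc d) (poly-const (suc d) c) (poly-linear d a b (poly-affine d a b p)))

poly-sum : ∀ d n {f : ℕ → ℚ → ℚ} → (∀ i → i ≤ n → Poly d (f i)) → Poly d (λ t → sumℚ n (λ i → f i t))
poly-sum d zero    p = p 0 z≤n
poly-sum d (suc n) p = poly-+ d (poly-sum d n (λ i i≤n → p i (ℕₚ.m≤n⇒m≤1+n i≤n))) (p (suc n) ℕₚ.≤-refl)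

-- Synthetic division by t - a: the constant term of the quotient is the value at a of the Horner
-- tail of f.
poly-quotient : ∀ d {f} a → Poly (suc d) f → ∃[ g ] Poly d g × (∀ t → f t ≡ f a + (t - a) * g t)
poly-quotient zero a (c , g , (c′ , g≗) , f≗) = g , (c′ , g≗) , λ t →
  trans (f≗ t) (trans (cong (λ z → c + t * z) (g≗ t)) (trans (shift c t a c′)
    (cong₂ (λ p q → p + (t - a) * q)
      (sym (trans (f≗ a) (cong (λ z → c + a * z) (g≗ a)))) (sym (g≗ t)))))
  where
  shift : ∀ c t a g → c + t * g ≡ c + a * g + (t - a) * g
  shift = solve-∀ ℚ-ring
poly-quotient (suc d) a (c , g , p , f≗) with poly-quotient d a p
... | h , q , g≗ = (λ t → g a + t * h t) , (g a , h , q , λ _ → refl) , λ t →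
  trans (f≗ t) (trans (cong (λ z → c + t * z) (g≗ t)) (trans (shift c t a (g a) (h t))
    (cong (λ z → z + (t - a) * (g a + t * h t)) (sym (f≗ a)))))
  where
  shift : ∀ c t a g h → c + t * (g + (t - a) * h) ≡ c + a * g + (t - a) * (g + t * h)
  shift = solve-∀ ℚ-ring

poly-difference : ∀ d {f} → Poly (suc d) f → Poly d (λ t → f t - f (1ℚ + t))
poly-difference zero {f} (c , g , (c′ , g≗) , f≗) = - c′ , λ t → trans
  (cong₂ _-_ (trans (f≗ t) (cong (λ z → c + t * z) (g≗ t)))
             (trans (f≗ (1ℚ + t)) (cong (λ z → c + (1ℚ + t) * z) (g≗ (1ℚ + t)))))
  (simplify c t c′)
  where
  simplify : ∀ c t g → (c + t * g) - (c + (1ℚ + t) * g) ≡ - g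
  simplify = solve-∀ ℚ-ring
poly-difference (suc d) {f} (c , g , p , f≗) = poly-ext (suc d)
  (λ t → trans (cong₂ _-_ (f≗ t) (f≗ (1ℚ + t))) (simplify c t (g t) (g (1ℚ + t))))
  -- The difference of t g(t) is t times the difference of g, whose degree has dropped by induction,
  -- minus g(1 + t), which is already of degree at most d + 1.
  (poly-+ (suc d) (poly-linear d 0ℚ 1ℚ (poly-difference d p))
    (poly-ext (suc d) {g = λ t → - 1ℚ * g (1ℚ + 1ℚ * t)} (λ t → cong (λ z → - 1ℚ * g (1ℚ + z)) (sym (ℚₚ.*-identityˡ t)))
      (poly-*ˡ (suc d) (- 1ℚ) (poly-affine (suc d) 1ℚ 1ℚ p))))
  where
  simplify : ∀ c t p q → (c + t * p) - (c + (1ℚ + t) * q) ≡ (0ℚ + 1ℚ * t) * (p - q) + - 1ℚ * q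
  simplify = solve-∀ ℚ-ring

-- Falling factorials and Stirling polynomials

falling : ℚ → ℕ → ℚ
falling t zero    = 1ℚ
falling t (suc j) = falling t j * (t - ι j)

-- Both sides are the product (1+t) t (t-1) ⋯ (t-j+1), with the largest factor split off on the left
-- and the smallest on the right.
falling-shift : ∀ t j → (1ℚ + t) * falling t j ≡ falling (1ℚ + t) j * ((1ℚ + t) - ι j)
falling-shift t zero    = unit t
  where
  unit : ∀ t → (1ℚ + t) * 1ℚ ≡ 1ℚ * ((1ℚ + t) - 0ℚ)
  unit = solve-∀ ℚ-ring
falling-shift t (suc j) = begin
  (1ℚ + t) * (falling t j * (t - ι j))                           ≡⟨ ℚₚ.*-assoc (1ℚ + t) (falling t j) (t - ι j) ⟨
  (1ℚ + t) * falling t j * (t - ι j)                             ≡⟨ cong (_* (t - ι j)) (falling-shift t j) ⟩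
  falling (1ℚ + t) (suc j) * (t - ι j)                           ≡⟨ cong (falling (1ℚ + t) (suc j) *_) (re t (ι j)) ⟩
  falling (1ℚ + t) (suc j) * ((1ℚ + t) - (1ℚ + ι j))             ≡⟨ cong (λ z → falling (1ℚ + t) (suc j) * ((1ℚ + t) - z)) (ι-suc j) ⟨
  falling (1ℚ + t) (suc j) * ((1ℚ + t) - ι (suc j))              ∎
  where
  open ≡-Reasoning
  re : ∀ t j → t - j ≡ (1ℚ + t) - (1ℚ + j)
  re = solve-∀ ℚ-ring

-- coeff m j is (number of partitions of an (m+j)-set into j blocks of size at least 2) / (m+j)!.
coeff : ℕ → ℕ → ℚ
coeff zero    zero    = 1ℚ
coeff zero    (suc j) = 0ℚ
coeff (suc m) zero    = 0ℚ
coeff (suc m) (suc j) = recip (m ℕ.+ suc j) * (ι (suc j) * coeff m (suc j) + coeff m j)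

-- For m < j an (m+j)-set is too small for j blocks of size at least 2.
coeff-> : ∀ m {j} → m < j → coeff m j ≡ 0ℚ
coeff-> zero    {suc j} _ = refl
coeff-> (suc m) {suc j} (s≤s m<j) = begin
  r * (ι (suc j) * coeff m (suc j) + coeff m j)
    ≡⟨ cong₂ (λ p q → r * (ι (suc j) * p + q)) (coeff-> m (ℕₚ.m<n⇒m<1+n m<j)) (coeff-> m m<j) ⟩
  r * (ι (suc j) * 0ℚ + 0ℚ)
    ≡⟨ vanish r (ι (suc j)) ⟩
  0ℚ ∎
  where
  open ≡-Reasoning
  r = recip (m ℕ.+ suc j)
  vanish : ∀ r j → r * (j * 0ℚ + 0ℚ) ≡ 0ℚ
  vanish = solve-∀ ℚ-ring

coeff-step : ∀ m j → (ι (suc m) + ι (suc j)) * coeff (suc m) (suc j) ≡ ι (suc j) * coeff m (suc j) + coeff m j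
coeff-step m j = begin
  (ι (suc m) + ι (suc j)) * (r * c)   ≡⟨ cong (_* (r * c)) (ι-+ (suc m) (suc j)) ⟨
  ι (suc (m ℕ.+ suc j)) * (r * c)     ≡⟨ swap (ι (suc (m ℕ.+ suc j))) r c ⟩
  r * ι (suc (m ℕ.+ suc j)) * c       ≡⟨ cong (_* c) (recip-inverseˡ (m ℕ.+ suc j)) ⟩
  1ℚ * c                              ≡⟨ ℚₚ.*-identityˡ c ⟩
  c                                   ∎
  where
  open ≡-Reasoning
  r = recip (m ℕ.+ suc j)
  c = ι (suc j) * coeff m (suc j) + coeff m j
  swap : ∀ n r c → n * (r * c) ≡ r * n * c
  swap = solve-∀ ℚ-ring

-- stirlingPoly m t is the coefficient of yᵐ in ((e^y − 1)/y)^t.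
stirlingPoly : ℕ → ℚ → ℚ
stirlingPoly m t = sumℚ m (λ j → coeff m j * falling t j)

poly-falling : ∀ j → Poly j (λ t → falling t j)
poly-falling zero    = 1ℚ , λ _ → refl
poly-falling (suc j) = poly-ext (suc j) (λ t → swap (falling t j) t (ι j)) (poly-linear j (- ι j) 1ℚ (poly-falling j))
  where
  swap : ∀ f t j → f * (t - j) ≡ (- j + 1ℚ * t) * f
  swap = solve-∀ ℚ-ring

poly-stirlingPoly : ∀ m → Poly m (stirlingPoly m)
poly-stirlingPoly m = poly-sum m m (λ j j≤m → poly-*ˡ m (coeff m j) (poly-weaken-≤ j≤m (poly-falling j)))

-- F = (e^y - 1)/y satisfies y F′ = 1 + y F - F. With u = 1 + t, this compares the coefficients of
-- y^{m+1} in y (F^u)′ = u (F^{u-1} + y F^u - F^u).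
stirlingPoly-step : ∀ m t → (1ℚ + t + ι (suc m)) * stirlingPoly (suc m) (1ℚ + t)
  ≡ (1ℚ + t) * (stirlingPoly (suc m) t + stirlingPoly m (1ℚ + t))
stirlingPoly-step m t = begin
  (u + M) * sumℚ (suc m) (λ j → coeff (suc m) j * falling u j)
    ≡⟨ sum-*ˡ (suc m) (u + M) (λ j → coeff (suc m) j * falling u j) ⟨
  sumℚ (suc m) (λ j → (u + M) * (coeff (suc m) j * falling u j))
    ≡⟨ sum-cong (suc m) (λ j → split u M (ι j) (coeff (suc m) j) (falling u j)) ⟩
  sumℚ (suc m) (λ j → coeff (suc m) j * (falling u j * (u - ι j)) + a j)
    ≡⟨ sum-cong (suc m) (λ j → cong (λ z → coeff (suc m) j * z + a j) (sym (falling-shift t j))) ⟩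
  sumℚ (suc m) (λ j → coeff (suc m) j * (u * falling t j) + a j)
    ≡⟨ sum-+ (suc m) (λ j → coeff (suc m) j * (u * falling t j)) a ⟩
  sumℚ (suc m) (λ j → coeff (suc m) j * (u * falling t j)) + sumℚ (suc m) a
    ≡⟨ cong₂ _+_ (trans (sum-cong (suc m) (λ j → *-left-comm (coeff (suc m) j) u (falling t j))) (sum-*ˡ (suc m) u (λ j → coeff (suc m) j * falling t j))) sum-a ⟩
  u * stirlingPoly (suc m) t + u * stirlingPoly m u
    ≡⟨ ℚₚ.*-distribˡ-+ u (stirlingPoly (suc m) t) (stirlingPoly m u) ⟨
  u * (stirlingPoly (suc m) t + stirlingPoly m u)
    ∎
  where
  open ≡-Reasoning
  u M : ℚ
  u = 1ℚ + t
  M = ι (suc m)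
  a b c : ℕ → ℚ
  a j = (M + ι j) * coeff (suc m) j * falling u j
  b j = ι j * coeff m j * falling u j
  c j = coeff m j * falling u (suc j)
  -- u + M is split as (u - j) + (M + j): the first summand raises the falling factorial for
  -- `falling-shift`, the second is the left factor in the recurrence of `coeff`.
  split : ∀ u M j c f → (u + M) * (c * f) ≡ c * (f * (u - j)) + (M + j) * c * f
  split = solve-∀ ℚ-ring
  a₀ : a 0 ≡ 0ℚ
  a₀ = vanish (M + ι 0) (falling u 0)
    where
    vanish : ∀ p q → p * 0ℚ * q ≡ 0ℚ
    vanish = solve-∀ ℚ-ring
  b₀ : b 0 ≡ 0ℚ
  b₀ = vanish (coeff m 0) (falling u 0)
    where
    vanish : ∀ p q → 0ℚ * p * q ≡ 0ℚ
    vanish = solve-∀ ℚ-ring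
  b-last : b (suc m) ≡ 0ℚ
  b-last = trans (cong (λ z → M * z * falling u (suc m)) (coeff-> m (ℕₚ.n<1+n m))) (vanish M (falling u (suc m)))
    where
    vanish : ∀ p q → p * 0ℚ * q ≡ 0ℚ
    vanish = solve-∀ ℚ-ring
  a-suc : ∀ j → a (suc j) ≡ b (suc j) + c j
  a-suc j = trans (cong (_* falling u (suc j)) (coeff-step m j)) (ℚₚ.*-distribʳ-+ (falling u (suc j)) (ι (suc j) * coeff m (suc j)) (coeff m j))
  sum-b : sumℚ m (λ j → b (suc j)) ≡ sumℚ m b
  sum-b = begin
    sumℚ m (λ j → b (suc j))         ≡⟨ ℚₚ.+-identityˡ _ ⟨
    0ℚ + sumℚ m (λ j → b (suc j))    ≡⟨ cong (_+ sumℚ m (λ j → b (suc j))) b₀ ⟨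
    b 0 + sumℚ m (λ j → b (suc j))   ≡⟨ sum-first m b ⟨
    sumℚ m b + b (suc m)             ≡⟨ cong (λ z → sumℚ m b + z) b-last ⟩
    sumℚ m b + 0ℚ                    ≡⟨ ℚₚ.+-identityʳ (sumℚ m b) ⟩
    sumℚ m b                         ∎
  sum-a : sumℚ (suc m) a ≡ u * stirlingPoly m u
  sum-a = begin
    sumℚ (suc m) a                                   ≡⟨ sum-first m a ⟩
    a 0 + sumℚ m (λ j → a (suc j))                   ≡⟨ trans (cong (_+ sumℚ m (λ j → a (suc j))) a₀) (ℚₚ.+-identityˡ _) ⟩
    sumℚ m (λ j → a (suc j))                         ≡⟨ sum-cong m a-suc ⟩
    sumℚ m (λ j → b (suc j) + c j)                   ≡⟨ sum-+ m (λ j → b (suc j)) c ⟩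
    sumℚ m (λ j → b (suc j)) + sumℚ m c              ≡⟨ cong (_+ sumℚ m c) sum-b ⟩
    sumℚ m b + sumℚ m c                              ≡⟨ sum-+ m b c ⟨
    sumℚ m (λ j → b j + c j)                         ≡⟨ sum-cong m (λ j → merge (ι j) (coeff m j) (falling u j) u) ⟩
    sumℚ m (λ j → u * (coeff m j * falling u j))     ≡⟨ sum-*ˡ m u (λ j → coeff m j * falling u j) ⟩
    u * stirlingPoly m u                             ∎
    where
    merge : ∀ j c f u → j * c * f + c * (f * (u - j)) ≡ u * (c * f)
    merge = solve-∀ ℚ-ring

-- At t = -1 the right side of the functional equation has the factor 0.
stirlingPoly-at-0 : ∀ m → stirlingPoly (suc m) 0ℚ ≡ 0ℚ
stirlingPoly-at-0 m = ι-cancelˡ m (trans (pad (ι (suc m)) (stirlingPoly (suc m) 0ℚ))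
  (trans (stirlingPoly-step m (- 1ℚ)) (vanish (stirlingPoly (suc m) (- 1ℚ) + stirlingPoly m 0ℚ) (ι (suc m)))))
  where
  pad : ∀ m s → m * s ≡ (0ℚ + m) * s
  pad = solve-∀ ℚ-ring
  vanish : ∀ s m → 0ℚ * s ≡ m * 0ℚ
  vanish = solve-∀ ℚ-ring

-- ℬ and 𝒜 as polynomial values

fac : ℕ → ℚ
fac n = ι (n !)

invFac : ℕ → ℚ
invFac zero    = 1ℚ
invFac (suc n) = recip n * invFac n

fac-suc : ∀ n → fac (suc n) ≡ ι (suc n) * fac n
fac-suc n = ι-* (suc n) (n !)

invFac-suc : ∀ n → ι (suc n) * invFac (suc n) ≡ invFac n
invFac-suc n = trans (swap (ι (suc n)) (recip n) (invFac n))
  (trans (cong (_* invFac n) (recip-inverseˡ n)) (ℚₚ.*-identityˡ (invFac n)))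
  where
  swap : ∀ n r i → n * (r * i) ≡ r * n * i
  swap = solve-∀ ℚ-ring

invFac-* : ∀ n → invFac n * fac n ≡ 1ℚ
invFac-* zero    = refl
invFac-* (suc n) = begin
  invFac (suc n) * fac (suc n)               ≡⟨ cong (invFac (suc n) *_) (fac-suc n) ⟩
  invFac (suc n) * (ι (suc n) * fac n)       ≡⟨ swap (invFac (suc n)) (ι (suc n)) (fac n) ⟩
  ι (suc n) * invFac (suc n) * fac n         ≡⟨ cong (_* fac n) (invFac-suc n) ⟩
  invFac n * fac n                           ≡⟨ invFac-* n ⟩
  1ℚ                                         ∎
  where
  open ≡-Reasoning
  swap : ∀ i n f → i * (n * f) ≡ n * i * f
  swap = solve-∀ ℚ-ring

fac-solve : ∀ n {p q} → fac n * p ≡ q → p ≡ invFac n * q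
fac-solve n {p} {q} eq = begin
  p                        ≡⟨ ℚₚ.*-identityˡ p ⟨
  1ℚ * p                   ≡⟨ cong (_* p) (invFac-* n) ⟨
  invFac n * fac n * p     ≡⟨ ℚₚ.*-assoc (invFac n) (fac n) p ⟩
  invFac n * (fac n * p)   ≡⟨ cong (invFac n *_) eq ⟩
  invFac n * q             ∎
  where open ≡-Reasoning

binomial-fac : ∀ a b → ι ((a ℕ.+ b) C a) * (fac a * fac b) ≡ fac (a ℕ.+ b)
binomial-fac a b = trans (cong (ι ((a ℕ.+ b) C a) *_) (sym (ι-* (a !) (b !))))
  (trans (sym (ι-* ((a ℕ.+ b) C a) (a ! ℕ.* b !))) (cong ι eq))
  where
  a≤a+b = ℕₚ.m≤m+n a b
  instance
    a!b!≢0 : ℕ.NonZero (a ! ℕ.* ((a ℕ.+ b) ∸ a) !)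
    a!b!≢0 = ℕₚ.m*n≢0 (a !) (((a ℕ.+ b) ∸ a) !) {{a ℕₚ.!≢0}} {{((a ℕ.+ b) ∸ a) ℕₚ.!≢0}}
  eq : ((a ℕ.+ b) C a) ℕ.* (a ! ℕ.* b !) ≡ (a ℕ.+ b) !
  eq = trans (cong (λ i → ((a ℕ.+ b) C a) ℕ.* (a ! ℕ.* i !)) (sym (ℕₚ.m+n∸m≡n a b)))
    (trans (cong (ℕ._* (a ! ℕ.* ((a ℕ.+ b) ∸ a) !)) (nCk≡n!/k![n-k]! a≤a+b))
      (m/n*n≡m (k![n∸k]!∣n! a≤a+b)))

stirling2-< : ∀ n k → n < k → stirling2 n k ≡ 0
stirling2-< zero    (suc k) _         = refl
stirling2-< (suc n) (suc k) (s≤s n<k) = trans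
  (cong₂ (λ p q → suc k ℕ.* p ℕ.+ q) (stirling2-< n (suc k) (ℕₚ.m<n⇒m<1+n n<k)) (stirling2-< n k n<k))
  (trans (ℕₚ.+-identityʳ (suc k ℕ.* 0)) (ℕₚ.*-zeroʳ (suc k)))

stirling2-n-n : ∀ n → stirling2 n n ≡ 1
stirling2-n-n zero    = refl
stirling2-n-n (suc n) = cong₂ ℕ._+_
  (trans (cong (suc n ℕ.*_) (stirling2-< n (suc n) (ℕₚ.n<1+n n))) (ℕₚ.*-zeroʳ (suc n))) (stirling2-n-n n)

stirling1-< : ∀ n k → n < k → stirling1 n k ≡ 0
stirling1-< zero    (suc k) _         = refl
stirling1-< (suc n) (suc k) (s≤s n<k) = trans
  (cong₂ (λ p q → n ℕ.* p ℕ.+ q) (stirling1-< n (suc k) (ℕₚ.m<n⇒m<1+n n<k)) (stirling1-< n k n<k))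
  (trans (ℕₚ.+-identityʳ (n ℕ.* 0)) (ℕₚ.*-zeroʳ n))

stirling1-n-n : ∀ n → stirling1 n n ≡ 1
stirling1-n-n zero    = refl
stirling1-n-n (suc n) = cong₂ ℕ._+_
  (trans (cong (n ℕ.*_) (stirling1-< n (suc n) (ℕₚ.n<1+n n))) (ℕₚ.*-zeroʳ n)) (stirling1-n-n n)

-- Up to factorials, the functional equation at t = k is the recurrence of `stirling2`.
stirling2-poly : ∀ m k → fac k * ι (stirling2 (m ℕ.+ k) k) ≡ fac (m ℕ.+ k) * stirlingPoly m (ι k)
stirling2-poly zero    k       = cong (λ s → fac k * ι s) (stirling2-n-n k)
stirling2-poly (suc m) zero    = trans (ℚₚ.*-zeroʳ (fac 0))
  (sym (trans (cong (fac (suc m ℕ.+ 0) *_) (stirlingPoly-at-0 m)) (ℚₚ.*-zeroʳ (fac (suc m ℕ.+ 0)))))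
stirling2-poly (suc m) (suc k) = begin
  fac (suc k) * ι (suc k ℕ.* A ℕ.+ B)
    ≡⟨ cong₂ _*_ (fac-suc k) (trans (ι-+ (suc k ℕ.* A) B) (cong (_+ ι B) (ι-* (suc k) A))) ⟩
  κ * fac k * (κ * ι A + ι B)
    ≡⟨ regroup κ (fac k) (ι A) (ι B) ⟩
  κ * (κ * fac k * ι A + fac k * ι B)
    ≡⟨ cong (λ z → κ * (z * ι A + fac k * ι B)) (fac-suc k) ⟨
  κ * (fac (suc k) * ι A + fac k * ι B)
    ≡⟨ cong₂ (λ p q → κ * (p + q)) (stirling2-poly m (suc k)) IH ⟩
  κ * (fac N * stirlingPoly m κ + fac N * stirlingPoly (suc m) (ι k))
    ≡⟨ factor κ (fac N) (stirlingPoly m κ) (stirlingPoly (suc m) (ι k)) ⟩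
  fac N * (κ * (stirlingPoly (suc m) (ι k) + stirlingPoly m κ))
    ≡⟨ cong (fac N *_) step ⟨
  fac N * (ι (suc N) * stirlingPoly (suc m) κ)
    ≡⟨ swap (fac N) (ι (suc N)) (stirlingPoly (suc m) κ) ⟩
  ι (suc N) * fac N * stirlingPoly (suc m) κ
    ≡⟨ cong (_* stirlingPoly (suc m) κ) (fac-suc N) ⟨
  fac (suc N) * stirlingPoly (suc m) κ
    ∎
  where
  open ≡-Reasoning
  N A B : ℕ
  N = m ℕ.+ suc k
  A = stirling2 N (suc k)
  B = stirling2 N k
  κ : ℚ
  κ = ι (suc k)
  IH : fac k * ι B ≡ fac N * stirlingPoly (suc m) (ι k)
  IH = subst (λ i → fac k * ι (stirling2 i k) ≡ fac i * stirlingPoly (suc m) (ι k)) (sym (ℕₚ.+-suc m k)) (stirling2-poly (suc m) k)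
  step : ι (suc N) * stirlingPoly (suc m) κ ≡ κ * (stirlingPoly (suc m) (ι k) + stirlingPoly m κ)
  step = begin
    ι (suc N) * stirlingPoly (suc m) κ                        ≡⟨ cong (_* stirlingPoly (suc m) κ) (trans (ι-+ (suc m) (suc k)) (ℚₚ.+-comm (ι (suc m)) κ)) ⟩
    (κ + ι (suc m)) * stirlingPoly (suc m) κ                  ≡⟨ subst (λ u → (u + ι (suc m)) * stirlingPoly (suc m) u ≡ u * (stirlingPoly (suc m) (ι k) + stirlingPoly m u)) (sym (ι-suc k)) (stirlingPoly-step m (ι k)) ⟩
    κ * (stirlingPoly (suc m) (ι k) + stirlingPoly m κ)       ∎
  regroup : ∀ k f a b → k * f * (k * a + b) ≡ k * (k * f * a + f * b)
  regroup = solve-∀ ℚ-ring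
  factor : ∀ k f a b → k * (f * a + f * b) ≡ f * (k * (b + a))
  factor = solve-∀ ℚ-ring
  swap : ∀ a b c → a * (b * c) ≡ b * a * c
  swap = solve-∀ ℚ-ring

sign : ℕ → ℚ
sign = exp (- 1ℚ)

-- With N = m + j + 1, the functional equation at t = -(N+1) is the recurrence of `stirling1`: this
-- is the duality of the two kinds.
stirling1-poly : ∀ m j → fac j * ι (stirling1 (m ℕ.+ suc j) (suc j))
  ≡ sign m * fac (m ℕ.+ j) * stirlingPoly m (- ι (m ℕ.+ suc j))
stirling1-poly zero    j = trans (cong (λ s → fac j * ι s) (stirling1-n-n (suc j))) (unit (fac j))
  where
  unit : ∀ f → f * 1ℚ ≡ 1ℚ * f * (1ℚ * 1ℚ)
  unit = solve-∀ ℚ-ring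
stirling1-poly (suc m) j = begin
  fac j * ι (N ℕ.* A ℕ.+ B)
    ≡⟨ cong (fac j *_) (trans (ι-+ (N ℕ.* A) B) (cong (_+ ι B) (ι-* N A))) ⟩
  fac j * (ι N * ι A + ι B)
    ≡⟨ regroup (fac j) (ι N) (ι A) (ι B) ⟩
  ι N * (fac j * ι A) + fac j * ι B
    ≡⟨ cong₂ (λ p q → ι N * p + q) (stirling1-poly m j) (below j) ⟩
  ι N * (sign m * F * stirlingPoly m (- ι N)) + ι j * (- 1ℚ * sign m * F * stirlingPoly (suc m) (- ι N))
    ≡⟨ collect (ι N) (sign m) F (stirlingPoly m (- ι N)) (ι j) (stirlingPoly (suc m) (- ι N)) ⟩
  - 1ℚ * sign m * F * (- ι N * stirlingPoly m (- ι N) - (- ι j) * stirlingPoly (suc m) (- ι N))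
    ≡⟨ cong (- 1ℚ * sign m * F *_) step ⟩
  - 1ℚ * sign m * F * (ι N * stirlingPoly (suc m) (- ι (suc N)))
    ≡⟨ swap (- 1ℚ * sign m) F (ι N) (stirlingPoly (suc m) (- ι (suc N))) ⟩
  - 1ℚ * sign m * (ι N * F) * stirlingPoly (suc m) (- ι (suc N))
    ≡⟨ cong (λ z → - 1ℚ * sign m * z * stirlingPoly (suc m) (- ι (suc N))) (trans (cong (λ i → ι i * F) (ℕₚ.+-suc m j)) (sym (fac-suc (m ℕ.+ j)))) ⟩
  sign (suc m) * fac (suc m ℕ.+ j) * stirlingPoly (suc m) (- ι (suc N))
    ∎
  where
  open ≡-Reasoning
  N A B : ℕ
  N = m ℕ.+ suc j
  A = stirling1 N (suc j)
  B = stirling1 N j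
  F : ℚ
  F = fac (m ℕ.+ j)
  -- The induction hypothesis for column j, rescaled by j so that it also covers j = 0, where both
  -- sides vanish.
  below : ∀ j → fac j * ι (stirling1 (m ℕ.+ suc j) j)
    ≡ ι j * (sign (suc m) * fac (m ℕ.+ j) * stirlingPoly (suc m) (- ι (m ℕ.+ suc j)))
  below zero = trans (cong (λ i → fac 0 * ι (stirling1 i 0)) (ℕₚ.+-suc m 0))
    (trans (ℚₚ.*-zeroʳ (fac 0)) (sym (ℚₚ.*-zeroˡ (sign (suc m) * fac (m ℕ.+ 0) * stirlingPoly (suc m) (- ι (m ℕ.+ 1))))))
  below (suc i) = begin
    fac (suc i) * ι (stirling1 (m ℕ.+ suc (suc i)) (suc i))
      ≡⟨ cong₂ (λ p q → p * ι (stirling1 q (suc i))) (fac-suc i) (ℕₚ.+-suc m (suc i)) ⟩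
    ι (suc i) * fac i * ι (stirling1 (suc m ℕ.+ suc i) (suc i))
      ≡⟨ ℚₚ.*-assoc (ι (suc i)) (fac i) (ι (stirling1 (suc m ℕ.+ suc i) (suc i))) ⟩
    ι (suc i) * (fac i * ι (stirling1 (suc m ℕ.+ suc i) (suc i)))
      ≡⟨ cong (ι (suc i) *_) (stirling1-poly (suc m) i) ⟩
    ι (suc i) * (sign (suc m) * fac (suc m ℕ.+ i) * stirlingPoly (suc m) (- ι (suc m ℕ.+ suc i)))
      ≡⟨ cong₂ (λ p q → ι (suc i) * (sign (suc m) * fac p * stirlingPoly (suc m) (- ι q))) (ℕₚ.+-suc m i) (ℕₚ.+-suc m (suc i)) ⟨
    ι (suc i) * (sign (suc m) * fac (m ℕ.+ suc i) * stirlingPoly (suc m) (- ι (m ℕ.+ suc (suc i))))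
      ∎
  step : - ι N * stirlingPoly m (- ι N) - (- ι j) * stirlingPoly (suc m) (- ι N) ≡ ι N * stirlingPoly (suc m) (- ι (suc N))
  step = begin
    - ι N * p - (- ι j) * q
      ≡⟨ cong (λ z → - ι N * p - z * q) -j ⟩
    - ι N * p - (- ι N + ι (suc m)) * q
      ≡⟨ cong (λ z → - ι N * p - z) functional ⟩
    - ι N * p - - ι N * (r + p)
      ≡⟨ cancel (ι N) p r ⟩
    ι N * r
      ∎
    where
    p q r : ℚ
    p = stirlingPoly m (- ι N)
    q = stirlingPoly (suc m) (- ι N)
    r = stirlingPoly (suc m) (- ι (suc N))
    cancel : ∀ n p r → - n * p - - n * (r + p) ≡ n * r
    cancel = solve-∀ ℚ-ring
    -j : - ι j ≡ - ι N + ι (suc m)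
    -j = trans (rearrange (ι (suc m)) (ι j)) (cong (λ z → - z + ι (suc m)) (sym (trans (cong ι (ℕₚ.+-suc m j)) (ι-+ (suc m) j))))
      where
      rearrange : ∀ m j → - j ≡ - (m + j) + m
      rearrange = solve-∀ ℚ-ring
    -N : 1ℚ + - ι (suc N) ≡ - ι N
    -N = trans (cong (λ z → 1ℚ + - z) (ι-suc N)) (rearrange (ι N))
      where
      rearrange : ∀ n → 1ℚ + - (1ℚ + n) ≡ - n
      rearrange = solve-∀ ℚ-ring
    functional : (- ι N + ι (suc m)) * q ≡ - ι N * (r + p)
    functional = subst (λ u → (u + ι (suc m)) * stirlingPoly (suc m) u ≡ u * (r + stirlingPoly m u)) -N (stirlingPoly-step m (- ι (suc N)))
  regroup : ∀ f n a b → f * (n * a + b) ≡ n * (f * a) + f * b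
  regroup = solve-∀ ℚ-ring
  collect : ∀ n s f p j q → n * (s * f * p) + j * (- 1ℚ * s * f * q) ≡ - 1ℚ * s * f * (- n * p - (- j) * q)
  collect = solve-∀ ℚ-ring
  swap : ∀ a b c d → a * b * (c * d) ≡ a * (c * b) * d
  swap = solve-∀ ℚ-ring

sum-truncate : ∀ n k f → (∀ i → n < i → f i ≡ 0ℚ) → sumℚ (n ℕ.+ k) f ≡ sumℚ n f
sum-truncate n zero    f f≡0 = cong (λ i → sumℚ i f) (ℕₚ.+-identityʳ n)
sum-truncate n (suc k) f f≡0 = trans (cong (λ i → sumℚ i f) (ℕₚ.+-suc n k))
  (trans (cong₂ _+_ (sum-truncate n k f f≡0) (f≡0 (suc (n ℕ.+ k)) (s≤s (ℕₚ.m≤m+n n k)))) (ℚₚ.+-identityʳ (sumℚ n f)))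

-- ℬ (n+k) k and 𝒜 (n+k) k are values of this polynomial at k and at −(n+k), up to factorials.
reciprocityPoly : ℕ → ℚ → ℚ
reciprocityPoly n t = sumℚ n (λ h → bernoulli h * invFac h * (exp t h * stirlingPoly (n ∸ h) t))

poly-reciprocityPoly : ∀ n → Poly n (reciprocityPoly n)
poly-reciprocityPoly n = poly-sum n n (λ h h≤n → poly-*ˡ n (bernoulli h * invFac h)
  (subst (λ d → Poly d (λ t → exp t h * stirlingPoly (n ∸ h) t)) (ℕₚ.m+[n∸m]≡n h≤n) (poly-power h (poly-stirlingPoly (n ∸ h)))))
  where
  poly-power : ∀ h {d f} → Poly d f → Poly (h ℕ.+ d) (λ t → exp t h * f t)
  poly-power zero    {d} {f} p = poly-ext d (λ t → ℚₚ.*-identityˡ (f t)) p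
  poly-power (suc h) {d} {f} p = poly-ext (suc h ℕ.+ d) (λ t → swap t (exp t h) (f t)) (poly-linear (h ℕ.+ d) 0ℚ 1ℚ (poly-power h p))
    where
    swap : ∀ t e f → t * e * f ≡ (0ℚ + 1ℚ * t) * (e * f)
    swap = solve-∀ ℚ-ring

-- At t = 0 the generating series is the constant 1.
reciprocityPoly-at-0 : ∀ n → reciprocityPoly (suc n) 0ℚ ≡ 0ℚ
reciprocityPoly-at-0 n = sum-0 (suc n) term
  where
  vanish₁ : ∀ a b → a * (b * 0ℚ) ≡ 0ℚ
  vanish₁ = solve-∀ ℚ-ring
  vanish₂ : ∀ a b c → a * (0ℚ * b * c) ≡ 0ℚ
  vanish₂ = solve-∀ ℚ-ring
  term : ∀ h → h ≤ suc n → bernoulli h * invFac h * (exp 0ℚ h * stirlingPoly (suc n ∸ h) 0ℚ) ≡ 0ℚ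
  term zero    _ = trans (cong (λ z → bernoulli 0 * invFac 0 * (exp 0ℚ 0 * z)) (stirlingPoly-at-0 n)) (vanish₁ (bernoulli 0 * invFac 0) (exp 0ℚ 0))
  term (suc h) _ = vanish₂ (bernoulli (suc h) * invFac (suc h)) (exp 0ℚ h) (stirlingPoly (n ∸ h) 0ℚ)

-- The factorial ((n-h)+k)! from `stirling2-poly` and the binomial C(n+k,h) combine to (n+k)!/h!;
-- only 1/h! depends on h, and it is part of `reciprocityPoly`.
ℬ-poly : ∀ n k → fac k * ℬ (n ℕ.+ k) k ≡ fac (n ℕ.+ k) * reciprocityPoly n (ι k)
ℬ-poly n k = begin
  fac k * sumℚ (n ℕ.+ k) t
    ≡⟨ cong (fac k *_) (sum-truncate n k t high) ⟩
  fac k * sumℚ n t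
    ≡⟨ sum-*ˡ n (fac k) t ⟨
  sumℚ n (λ h → fac k * t h)
    ≡⟨ sum-cong-≤ n low ⟩
  sumℚ n (λ h → fac (n ℕ.+ k) * (bernoulli h * invFac h * (exp (ι k) h * stirlingPoly (n ∸ h) (ι k))))
    ≡⟨ sum-*ˡ n (fac (n ℕ.+ k)) (λ h → bernoulli h * invFac h * (exp (ι k) h * stirlingPoly (n ∸ h) (ι k))) ⟩
  fac (n ℕ.+ k) * reciprocityPoly n (ι k)
    ∎
  where
  open ≡-Reasoning
  x : ℕ
  x = n ℕ.+ k
  t : ℕ → ℚ
  t h = bernoulli h * ι ((x C h) ℕ.* stirling2 (x ∸ h) k ℕ.* k ℕ.^ h)
  -- Beyond x the truncated difference `x ∸ h` is 0, and for k = 0 the Stirling number would then be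
  -- 1; there the binomial vanishes instead.
  high : ∀ h → n < h → t h ≡ 0ℚ
  high h n<h with h ℕ.≤? x
  ... | yes h≤x = trans (cong (λ s → bernoulli h * ι ((x C h) ℕ.* s ℕ.* k ℕ.^ h)) (stirling2-< (x ∸ h) k x∸h<k))
        (trans (cong (λ z → bernoulli h * ι (z ℕ.* k ℕ.^ h)) (ℕₚ.*-zeroʳ (x C h))) (ℚₚ.*-zeroʳ (bernoulli h)))
    where
    x∸h<k : x ∸ h < k
    x∸h<k = ℕₚ.+-cancelʳ-< h (x ∸ h) k
      (subst (_< k ℕ.+ h) (trans (ℕₚ.+-comm k n) (sym (ℕₚ.m∸n+n≡m h≤x))) (ℕₚ.+-monoʳ-< k n<h))
  ... | no h≰x = trans (cong (λ c → bernoulli h * ι (c ℕ.* stirling2 (x ∸ h) k ℕ.* k ℕ.^ h)) (k>n⇒nCk≡0 (ℕₚ.≰⇒> h≰x)))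
        (ℚₚ.*-zeroʳ (bernoulli h))
  low : ∀ h → h ≤ n → fac k * t h ≡ fac x * (bernoulli h * invFac h * (exp (ι k) h * stirlingPoly (n ∸ h) (ι k)))
  low h h≤n = begin
    fac k * t h
      ≡⟨ cong (λ z → fac k * (bernoulli h * z)) (trans (ι-* ((x C h) ℕ.* stirling2 (x ∸ h) k) (k ℕ.^ h)) (cong₂ _*_ (ι-* (x C h) (stirling2 (x ∸ h) k)) (sym (exp-ι k h)))) ⟩
    fac k * (bernoulli h * (c * ι (stirling2 (x ∸ h) k) * e))
      ≡⟨ cong (λ i → fac k * (bernoulli h * (c * ι (stirling2 i k) * e))) x∸h ⟩
    fac k * (bernoulli h * (c * ι (stirling2 ((n ∸ h) ℕ.+ k) k) * e))
      ≡⟨ shuffle₁ (fac k) (bernoulli h) c (ι (stirling2 ((n ∸ h) ℕ.+ k) k)) e ⟩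
    bernoulli h * (c * (fac k * ι (stirling2 ((n ∸ h) ℕ.+ k) k)) * e)
      ≡⟨ cong (λ z → bernoulli h * (c * z * e)) (stirling2-poly (n ∸ h) k) ⟩
    bernoulli h * (c * (f * p) * e)
      ≡⟨ shuffle₂ (bernoulli h) c f p e ⟩
    1ℚ * (c * f) * (bernoulli h * (e * p))
      ≡⟨ cong (λ z → z * (c * f) * (bernoulli h * (e * p))) (invFac-* h) ⟨
    invFac h * fac h * (c * f) * (bernoulli h * (e * p))
      ≡⟨ shuffle₃ (invFac h) (fac h) c f (bernoulli h) (e * p) ⟩
    c * (fac h * f) * (bernoulli h * invFac h * (e * p))
      ≡⟨ cong (_* (bernoulli h * invFac h * (e * p))) choose ⟩
    fac x * (bernoulli h * invFac h * (e * p))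
      ∎
    where
    c e f p : ℚ
    c = ι (x C h)
    e = exp (ι k) h
    f = fac ((n ∸ h) ℕ.+ k)
    p = stirlingPoly (n ∸ h) (ι k)
    x∸h : x ∸ h ≡ (n ∸ h) ℕ.+ k
    x∸h = ℕₚ.+-∸-comm k h≤n
    choose : c * (fac h * f) ≡ fac x
    choose = subst (λ z → ι (z C h) * (fac h * f) ≡ fac z)
      (trans (sym (ℕₚ.+-assoc h (n ∸ h) k)) (cong (ℕ._+ k) (ℕₚ.m+[n∸m]≡n h≤n))) (binomial-fac h ((n ∸ h) ℕ.+ k))
    shuffle₁ : ∀ k b c s e → k * (b * (c * s * e)) ≡ b * (c * (k * s) * e)
    shuffle₁ = solve-∀ ℚ-ring
    shuffle₂ : ∀ b c f p e → b * (c * (f * p) * e) ≡ 1ℚ * (c * f) * (b * (e * p))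
    shuffle₂ = solve-∀ ℚ-ring
    shuffle₃ : ∀ i a c f b q → i * a * (c * f) * (b * q) ≡ c * (a * f) * (b * i * q)
    shuffle₃ = solve-∀ ℚ-ring

-- C(k+h,h) h! k! = (h+k)! is precisely the prefactor in `stirling1-poly`, and its sign (-1)^{n-h}
-- together with x^h becomes (-1)^n (-x)^h, where x = n + k + 1.
𝒜-poly : ∀ n k → fac k * 𝒜 (n ℕ.+ suc k) (suc k)
  ≡ sign n * fac (n ℕ.+ k) * reciprocityPoly n (- ι (n ℕ.+ suc k))
𝒜-poly n k = begin
  fac k * sumℚ x t
    ≡⟨ cong (fac k *_) (sum-truncate n (suc k) t high) ⟩
  fac k * sumℚ n t
    ≡⟨ sum-*ˡ n (fac k) t ⟨
  sumℚ n (λ h → fac k * t h)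
    ≡⟨ sum-cong-≤ n low ⟩
  sumℚ n (λ h → sign n * fac (n ℕ.+ k) * (bernoulli h * invFac h * (exp (- ι x) h * stirlingPoly (n ∸ h) (- ι x))))
    ≡⟨ sum-*ˡ n (sign n * fac (n ℕ.+ k)) (λ h → bernoulli h * invFac h * (exp (- ι x) h * stirlingPoly (n ∸ h) (- ι x))) ⟩
  sign n * fac (n ℕ.+ k) * reciprocityPoly n (- ι x)
    ∎
  where
  open ≡-Reasoning
  x : ℕ
  x = n ℕ.+ suc k
  t : ℕ → ℚ
  -- With `suc k` as second index, k + 1 + h - 1 computes to a natural number, so `binomℤ` reduces
  -- to an ordinary binomial.
  t h = bernoulli h * toℚ (+ ((k ℕ.+ h) C h) ℤ.* + (stirling1 x (h ℕ.+ suc k) ℕ.* x ℕ.^ h))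
  t-split : ∀ h → t h ≡ bernoulli h * (ι ((k ℕ.+ h) C h) * (ι (stirling1 x (h ℕ.+ suc k)) * exp (ι x) h))
  t-split h = cong (bernoulli h *_) (trans (toℚ-* (+ ((k ℕ.+ h) C h)) (+ (stirling1 x (h ℕ.+ suc k) ℕ.* x ℕ.^ h)))
    (cong (ι ((k ℕ.+ h) C h) *_) (trans (ι-* (stirling1 x (h ℕ.+ suc k)) (x ℕ.^ h)) (cong (ι (stirling1 x (h ℕ.+ suc k)) *_) (sym (exp-ι x h))))))
  high : ∀ h → n < h → t h ≡ 0ℚ
  high h n<h = trans (t-split h) (trans
    (cong (λ s → bernoulli h * (ι ((k ℕ.+ h) C h) * (ι s * exp (ι x) h))) (stirling1-< x (h ℕ.+ suc k) (ℕₚ.+-monoˡ-< (suc k) n<h)))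
    (vanish (bernoulli h) (ι ((k ℕ.+ h) C h)) (exp (ι x) h)))
    where
    vanish : ∀ a b c → a * (b * (0ℚ * c)) ≡ 0ℚ
    vanish = solve-∀ ℚ-ring
  low : ∀ h → h ≤ n → fac k * t h ≡ sign n * fac (n ℕ.+ k) * (bernoulli h * invFac h * (exp (- ι x) h * stirlingPoly (n ∸ h) (- ι x)))
  low h h≤n = begin
    fac k * t h
      ≡⟨ cong (fac k *_) (t-split h) ⟩
    fac k * (b * (c * (s * e)))
      ≡⟨ shuffle₁ (fac k) b c s e ⟩
    b * 1ℚ * (c * fac k) * (s * e)
      ≡⟨ cong (λ z → b * z * (c * fac k) * (s * e)) (invFac-* h) ⟨
    b * (invFac h * fac h) * (c * fac k) * (s * e)
      ≡⟨ shuffle₂ b (invFac h) (fac h) c (fac k) s e ⟩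
    b * invFac h * (c * (fac h * fac k) * s * e)
      ≡⟨ cong (λ z → b * invFac h * (z * s * e)) choose ⟩
    b * invFac h * (fac (h ℕ.+ k) * s * e)
      ≡⟨ cong (λ z → b * invFac h * (z * e)) stirling ⟩
    b * invFac h * (sign (n ∸ h) * F * p * e)
      ≡⟨ cong (λ z → b * invFac h * (z * F * p * e)) (ℚₚ.*-identityʳ (sign (n ∸ h))) ⟨
    b * invFac h * (sign (n ∸ h) * 1ℚ * F * p * e)
      ≡⟨ cong (λ z → b * invFac h * (sign (n ∸ h) * z * F * p * e)) (sign-* h) ⟨
    b * invFac h * (sign (n ∸ h) * (sign h * sign h) * F * p * e)
      ≡⟨ shuffle₃ b (invFac h) (sign (n ∸ h)) (sign h) F p e ⟩
    sign (n ∸ h) * sign h * F * (b * invFac h * (sign h * e * p))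
      ≡⟨ cong₂ (λ p₁ p₂ → p₁ * F * (b * invFac h * (p₂ * p))) signs powers ⟩
    sign n * F * (b * invFac h * (exp (- ι x) h * p))
      ∎
    where
    b c s e F p : ℚ
    b = bernoulli h
    c = ι ((k ℕ.+ h) C h)
    s = ι (stirling1 x (h ℕ.+ suc k))
    e = exp (ι x) h
    F = fac (n ℕ.+ k)
    p = stirlingPoly (n ∸ h) (- ι x)
    n∸h+h : ∀ j → (n ∸ h) ℕ.+ (h ℕ.+ j) ≡ n ℕ.+ j
    n∸h+h j = trans (sym (ℕₚ.+-assoc (n ∸ h) h j)) (cong (ℕ._+ j) (ℕₚ.m∸n+n≡m h≤n))
    x≡ : (n ∸ h) ℕ.+ suc (h ℕ.+ k) ≡ x
    x≡ = trans (cong ((n ∸ h) ℕ.+_) (sym (ℕₚ.+-suc h k))) (n∸h+h (suc k))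
    choose : c * (fac h * fac k) ≡ fac (h ℕ.+ k)
    choose = subst (λ z → ι (z C h) * (fac h * fac k) ≡ fac (h ℕ.+ k)) (ℕₚ.+-comm h k) (binomial-fac h k)
    stirling : fac (h ℕ.+ k) * s ≡ sign (n ∸ h) * F * p
    stirling = begin
      fac (h ℕ.+ k) * s
        ≡⟨ cong₂ (λ i j → fac (h ℕ.+ k) * ι (stirling1 i j)) (sym x≡) (ℕₚ.+-suc h k) ⟩
      fac (h ℕ.+ k) * ι (stirling1 ((n ∸ h) ℕ.+ suc (h ℕ.+ k)) (suc (h ℕ.+ k)))
        ≡⟨ stirling1-poly (n ∸ h) (h ℕ.+ k) ⟩
      sign (n ∸ h) * fac ((n ∸ h) ℕ.+ (h ℕ.+ k)) * stirlingPoly (n ∸ h) (- ι ((n ∸ h) ℕ.+ suc (h ℕ.+ k)))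
        ≡⟨ cong₂ (λ i j → sign (n ∸ h) * fac i * stirlingPoly (n ∸ h) (- ι j)) (n∸h+h k) x≡ ⟩
      sign (n ∸ h) * F * p
        ∎
    signs : sign (n ∸ h) * sign h ≡ sign n
    signs = trans (sym (exp-+ (- 1ℚ) (n ∸ h) h)) (cong sign (ℕₚ.m∸n+n≡m h≤n))
    powers : sign h * e ≡ exp (- ι x) h
    powers = trans (sym (exp-* (- 1ℚ) (ι x) h)) (cong (λ a → exp a h) (neg (ι x)))
      where
      neg : ∀ a → - 1ℚ * a ≡ - a
      neg = solve-∀ ℚ-ring
    shuffle₁ : ∀ k b c s e → k * (b * (c * (s * e))) ≡ b * 1ℚ * (c * k) * (s * e)
    shuffle₁ = solve-∀ ℚ-ring
    shuffle₂ : ∀ b i f c k s e → b * (i * f) * (c * k) * (s * e) ≡ b * i * (c * (f * k) * s * e)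
    shuffle₂ = solve-∀ ℚ-ring
    shuffle₃ : ∀ b i s t f p e → b * i * (s * (t * t) * f * p * e) ≡ s * t * f * (b * i * (t * e * p))
    shuffle₃ = solve-∀ ℚ-ring

-- Interpolation

-- The alternating sum Σ_v (-1)^v C(n,v) f(v), written as a product with e^y so that the Leibniz
-- rule yields its difference recurrence.
alternating : ℕ → Seq → ℚ
alternating n f = (reflect f ⋆ exp 1ℚ) n

alternating-sum : ∀ n f → alternating n f ≡ sumℚ n (λ v → ι (n C v) * (sign v * f v))
alternating-sum n f = trans (⋆-binomial n (reflect f) (exp 1ℚ))
  (sum-cong n (λ v → cong (ι (n C v) *_) (trans (cong (sign v * f v *_) (exp-1 (n ∸ v))) (ℚₚ.*-identityʳ (sign v * f v)))))

alternating-cong : ∀ n {f g} → f ≗ g → alternating n f ≡ alternating n g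
alternating-cong n f≗g = ⋆-congʳ (exp 1ℚ) (λ i → cong (sign i *_) (f≗g i)) n

alternating-+ : ∀ n f g → alternating n (f ⊕ g) ≡ alternating n f + alternating n g
alternating-+ n f g = trans (⋆-congʳ (exp 1ℚ) (λ i → ℚₚ.*-distribˡ-+ (sign i) (f i) (g i)) n)
  (⋆-distribʳ-⊕ (exp 1ℚ) (reflect f) (reflect g) n)

alternating-· : ∀ n c f → alternating n (c · f) ≡ c * alternating n f
alternating-· n c f = trans (⋆-congʳ (exp 1ℚ) (λ i → *-left-comm (sign i) c (f i)) n) (·-⋆-assoc c (reflect f) (exp 1ℚ) n)

alternating-suc : ∀ n f → alternating (suc n) f ≡ alternating n f - alternating n (D f)
alternating-suc n f = begin
  (D (reflect f) ⋆ exp 1ℚ) n + (reflect f ⋆ (1ℚ · exp 1ℚ)) n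
    ≡⟨ cong₂ _+_
         (trans (⋆-congʳ (exp 1ℚ) (λ i → ℚₚ.*-assoc (- 1ℚ) (sign i) (f (suc i))) n) (·-⋆-assoc (- 1ℚ) (reflect (D f)) (exp 1ℚ) n))
         (⋆-·-comm 1ℚ (reflect f) (exp 1ℚ) n) ⟩
  - 1ℚ * alternating n (D f) + 1ℚ * alternating n f
    ≡⟨ rearrange (alternating n (D f)) (alternating n f) ⟩
  alternating n f - alternating n (D f)
    ∎
  where
  open ≡-Reasoning
  rearrange : ∀ a b → - 1ℚ * a + 1ℚ * b ≡ b - a
  rearrange = solve-∀ ℚ-ring

alternating-0 : ∀ n {f} → (∀ i → f i ≡ 0ℚ) → alternating n f ≡ 0ℚ
alternating-0 n f≡0 = trans (⋆-congʳ (exp 1ℚ) (λ i → trans (cong (sign i *_) (f≡0 i)) (ℚₚ.*-zeroʳ (sign i))) n) (⋆-zeroˡ (exp 1ℚ) n)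

-- An n-th difference: each use of `alternating-suc` takes one difference and lowers the degree by
-- one.
alternating-poly : ∀ n d {f} → Poly d f → d < n → alternating n (λ v → f (ι v)) ≡ 0ℚ
alternating-poly (suc n) d {f} p (s≤s d≤n) = trans (alternating-suc n (λ v → f (ι v)))
  (trans (cong (λ z → alternating n (λ v → f (ι v)) + z) (sym (trans (alternating-· n (- 1ℚ) (λ v → f (ι (suc v)))) (neg (alternating n (λ v → f (ι (suc v))))))))
  (trans (sym (alternating-+ n (λ v → f (ι v)) ((- 1ℚ) · (λ v → f (ι (suc v))))))
  (trans (alternating-cong n difference) (vanish d p d≤n))))
  where
  neg : ∀ a → - 1ℚ * a ≡ - a
  neg = solve-∀ ℚ-ring
  difference : ∀ v → f (ι v) + - 1ℚ * f (ι (suc v)) ≡ f (ι v) - f (1ℚ + ι v)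
  difference v = cong (λ z → f (ι v) + z) (trans (neg (f (ι (suc v)))) (cong (λ z → - f z) (ι-suc v)))
  vanish : ∀ d → Poly d f → d ≤ n → alternating n (λ v → f (ι v) - f (1ℚ + ι v)) ≡ 0ℚ
  vanish zero    (c , f≗) _    = alternating-0 n (λ i → trans (cong₂ _-_ (f≗ (ι i)) (f≗ (1ℚ + ι i))) (ℚₚ.+-inverseʳ c))
  vanish (suc d) p        d<n = alternating-poly n d (poly-difference d p) d<n

-- The terms are 1/(x+v+1), so this is the Beta integral of s^x (1-s)^n over [0,1], with (1-s)^n
-- expanded on the left.
alternating-recip : ∀ n x → alternating n (λ v → recip (x ℕ.+ v)) ≡ fac n * fac x * invFac (suc (x ℕ.+ n))
alternating-recip zero x = begin
  1ℚ * recip (x ℕ.+ 0) * 1ℚ                      ≡⟨ unit (recip (x ℕ.+ 0)) ⟩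
  1ℚ * recip (x ℕ.+ 0)                           ≡⟨ cong (_* recip (x ℕ.+ 0)) (trans (cong (λ i → invFac i * fac x) (ℕₚ.+-identityʳ x)) (invFac-* x)) ⟨
  invFac (x ℕ.+ 0) * fac x * recip (x ℕ.+ 0)     ≡⟨ swap (invFac (x ℕ.+ 0)) (fac x) (recip (x ℕ.+ 0)) ⟩
  1ℚ * fac x * (recip (x ℕ.+ 0) * invFac (x ℕ.+ 0)) ∎
  where
  open ≡-Reasoning
  unit : ∀ r → 1ℚ * r * 1ℚ ≡ 1ℚ * r
  unit = solve-∀ ℚ-ring
  swap : ∀ i f r → i * f * r ≡ 1ℚ * f * (r * i)
  swap = solve-∀ ℚ-ring
alternating-recip (suc n) x = begin
  alternating (suc n) (λ v → recip (x ℕ.+ v))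
    ≡⟨ alternating-suc n (λ v → recip (x ℕ.+ v)) ⟩
  alternating n (λ v → recip (x ℕ.+ v)) - alternating n (λ v → recip (x ℕ.+ suc v))
    ≡⟨ cong₂ _-_ (alternating-recip n x)
         (trans (alternating-cong n (λ v → cong recip (ℕₚ.+-suc x v))) (alternating-recip n (suc x))) ⟩
  fac n * fac x * invFac (suc (x ℕ.+ n)) - fac n * fac (suc x) * i
    ≡⟨ cong₂ (λ p q → fac n * fac x * p - fac n * q * i) (sym (invFac-suc (suc (x ℕ.+ n)))) (fac-suc x) ⟩
  fac n * fac x * (ι (suc (suc x ℕ.+ n)) * i) - fac n * (ι (suc x) * fac x) * i
    ≡⟨ cong (λ z → fac n * fac x * (z * i) - fac n * (ι (suc x) * fac x) * i) (trans (cong ι (sym (ℕₚ.+-suc (suc x) n))) (ι-+ (suc x) (suc n))) ⟩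
  fac n * fac x * ((ι (suc x) + ι (suc n)) * i) - fac n * (ι (suc x) * fac x) * i
    ≡⟨ simplify (fac n) (fac x) (ι (suc x)) (ι (suc n)) i ⟩
  ι (suc n) * fac n * fac x * i
    ≡⟨ cong₂ (λ p j → p * fac x * invFac (suc j)) (fac-suc n) (ℕₚ.+-suc x n) ⟨
  fac (suc n) * fac x * invFac (suc (x ℕ.+ suc n))
    ∎
  where
  open ≡-Reasoning
  i = invFac (suc (suc x ℕ.+ n))
  simplify : ∀ f g a b i → f * g * ((a + b) * i) - f * (a * g) * i ≡ b * f * g * i
  simplify = solve-∀ ℚ-ring

-- Lagrange interpolation at the nodes 0, …, n, evaluated at −(x+1).
interpolation : ∀ n x {f} → Poly n f →
  alternating n (λ v → f (ι v) * recip (x ℕ.+ v)) ≡ f (- ι (suc x)) * (fac n * fac x * invFac (suc (x ℕ.+ n)))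
interpolation n x {f} p with remainder n p
  where
  z : ℚ
  z = - ι (suc x)
  -- Of the quotient only the vanishing of its alternating sum is kept: for n = 0 it is the zero
  -- function, of a degree that `Poly` cannot express.
  remainder : ∀ n → Poly n f → Σ[ g ∈ (ℚ → ℚ) ] alternating n (λ v → g (ι v)) ≡ 0ℚ × (∀ t → f t ≡ f z + (t - z) * g t)
  remainder zero    (c , f≗) = (λ _ → 0ℚ) , refl , λ t → trans (f≗ t) (trans (sym (f≗ z)) (pad (f z) (t - z)))
    where
    pad : ∀ a b → a ≡ a + b * 0ℚ
    pad = solve-∀ ℚ-ring
  remainder (suc d) p with poly-quotient d z p
  ... | g , q , f≗ = g , alternating-poly (suc d) d q (ℕₚ.n<1+n d) , f≗
... | g , g≡0 , f≗ = begin
  alternating n (λ v → f (ι v) * recip (x ℕ.+ v))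
    ≡⟨ alternating-cong n split ⟩
  alternating n ((f z · (λ v → recip (x ℕ.+ v))) ⊕ (λ v → g (ι v)))
    ≡⟨ alternating-+ n (f z · (λ v → recip (x ℕ.+ v))) (λ v → g (ι v)) ⟩
  alternating n (f z · (λ v → recip (x ℕ.+ v))) + alternating n (λ v → g (ι v))
    ≡⟨ cong₂ _+_ (trans (alternating-· n (f z) (λ v → recip (x ℕ.+ v))) (cong (f z *_) (alternating-recip n x))) g≡0 ⟩
  f z * (fac n * fac x * invFac (suc (x ℕ.+ n))) + 0ℚ
    ≡⟨ ℚₚ.+-identityʳ _ ⟩
  f z * (fac n * fac x * invFac (suc (x ℕ.+ n)))
    ∎
  where
  open ≡-Reasoning
  z : ℚ
  z = - ι (suc x)
  split : ∀ v → f (ι v) * recip (x ℕ.+ v) ≡ f z * recip (x ℕ.+ v) + g (ι v)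
  split v = begin
    f (ι v) * r
      ≡⟨ cong (_* r) (f≗ (ι v)) ⟩
    (f z + (ι v - z) * g (ι v)) * r
      ≡⟨ expand (f z) (ι v) (ι (suc x)) (g (ι v)) r ⟩
    f z * r + r * (ι (suc x) + ι v) * g (ι v)
      ≡⟨ cong (λ w → f z * r + w * g (ι v)) (trans (cong (r *_) (sym (ι-+ (suc x) v))) (recip-inverseˡ (x ℕ.+ v))) ⟩
    f z * r + 1ℚ * g (ι v)
      ≡⟨ cong (λ w → f z * r + w) (ℚₚ.*-identityˡ (g (ι v))) ⟩
    f z * r + g (ι v)
      ∎
    where
    r = recip (x ℕ.+ v)
    expand : ∀ a v x g r → (a + (v - - x) * g) * r ≡ a * r + r * (x + v) * g
    expand = solve-∀ ℚ-ring

-- The weights of the reciprocity formulas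

toℚ-sign : ∀ n → toℚ ((ℤ.- ℤ.1ℤ) ℤ.^ n) ≡ sign n
toℚ-sign zero    = refl
toℚ-sign (suc n) = trans (toℚ-* (ℤ.- ℤ.1ℤ) ((ℤ.- ℤ.1ℤ) ℤ.^ n)) (cong (- 1ℚ *_) (toℚ-sign n))

weight : ℕ → ℕ → ℕ → ℚ
weight n x u = toℚ (binomℤ (+ (n ℕ.+ x)) (n ∸ u) ℤ.* binomℤ (+ n ℤ.- + x) (n ℕ.+ u))

n-[n+k] : ∀ n k → + n ℤ.- + (n ℕ.+ k) ≡ ℤ.- + k
n-[n+k] n k = lem (+ n) (+ k)
  where
  lem : ∀ a b → a ℤ.- (a ℤ.+ b) ≡ ℤ.- b
  lem = ℤSolver.solve-∀

ℬ-suc-0 : ∀ n → ℬ (suc n ℕ.+ 0) 0 ≡ 0ℚ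
ℬ-suc-0 n = trans (fac-solve 0 (trans (ℬ-poly (suc n) 0) (trans (cong (f *_) (reciprocityPoly-at-0 n)) (ℚₚ.*-zeroʳ f)))) (ℚₚ.*-zeroʳ (invFac 0))
  where f = fac (suc n ℕ.+ 0)

𝒜-suc-0 : ∀ n → 𝒜 (suc n) 0 ≡ 0ℚ
𝒜-suc-0 n = sum-0 (suc n) (λ h _ → trans (cong (λ z → bernoulli h * toℚ z) (term h)) (ℚₚ.*-zeroʳ (bernoulli h)))
  where
  term : ∀ h → binomℤ (+ 0 ℤ.+ + h ℤ.- ℤ.1ℤ) h ℤ.* + (stirling1 (suc n) (h ℕ.+ 0) ℕ.* suc n ℕ.^ h) ≡ ℤ.0ℤ
  -- For h = 0 the Stirling number vanishes, otherwise the binomial, whose lower index exceeds the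
  -- upper one by 1.
  term zero    = refl
  term (suc h) = cong (λ c → + c ℤ.* + (stirling1 (suc n) (suc h ℕ.+ 0) ℕ.* suc n ℕ.^ suc h)) (k>n⇒nCk≡0 (ℕₚ.n<1+n h))

poly-root-0 : ∀ {d f} → Poly (suc d) f → f 0ℚ ≡ 0ℚ → ∃[ g ] Poly d g × (∀ t → f t ≡ t * g t)
poly-root-0 (c , g , p , f≗) f₀≡0 = g , p , λ t → trans (f≗ t) (trans (cong (_+ t * g t) c≡0) (ℚₚ.+-identityˡ (t * g t)))
  where
  pad : ∀ c r → c ≡ c + 0ℚ * r
  pad = solve-∀ ℚ-ring
  c≡0 : c ≡ 0ℚ
  c≡0 = trans (pad c (g 0ℚ)) (trans (sym (f≗ 0ℚ)) f₀≡0)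

module _ (N K : ℕ) where
  private
    n x : ℕ
    n = suc N
    x = n ℕ.+ suc K

  -- With u = v + 1 the first binomial has (x+v+1)! in its denominator and the second, up to sign,
  -- has (K+w)! = (x+v)! in its numerator. What survives is 1/(x+v+1), next to C(N,v) the Lagrange
  -- weight of node v for the point -(x+1).
  weight-suc : ∀ v → v ≤ N → weight n x (suc v)
    ≡ fac (n ℕ.+ x) * invFac K * invFac N * sign (n ℕ.+ suc v) * (ι (N C v) * recip (x ℕ.+ v)) * (fac v * invFac (n ℕ.+ suc v))
  weight-suc v v≤N = begin
    toℚ (+ ((n ℕ.+ x) C r) ℤ.* binomℤ (+ n ℤ.- + x) w)
      ≡⟨ cong (λ z → toℚ (+ ((n ℕ.+ x) C r) ℤ.* binomℤ z w)) (n-[n+k] n (suc K)) ⟩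
    toℚ (+ ((n ℕ.+ x) C r) ℤ.* ((ℤ.- ℤ.1ℤ) ℤ.^ w ℤ.* + ((K ℕ.+ w) C w)))
      ≡⟨ trans (toℚ-* (+ ((n ℕ.+ x) C r)) ((ℤ.- ℤ.1ℤ) ℤ.^ w ℤ.* + ((K ℕ.+ w) C w)))
           (cong (ι ((n ℕ.+ x) C r) *_) (trans (toℚ-* ((ℤ.- ℤ.1ℤ) ℤ.^ w) (+ ((K ℕ.+ w) C w))) (cong (_* ι ((K ℕ.+ w) C w)) (toℚ-sign w)))) ⟩
    ι ((n ℕ.+ x) C r) * (sign w * ι ((K ℕ.+ w) C w))
      ≡⟨ cong₂ (λ p q → p * (sign w * q)) first second ⟩
    fac v * c * invFac N * (ρ * invFac (K ℕ.+ w)) * fac (n ℕ.+ x) * (sign w * (invFac K * invFac w * fac (K ℕ.+ w)))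
      ≡⟨ shuffle (fac v) c (invFac N) ρ (invFac (K ℕ.+ w)) (fac (n ℕ.+ x)) (sign w) (invFac K) (invFac w) (fac (K ℕ.+ w)) ⟩
    invFac (K ℕ.+ w) * fac (K ℕ.+ w) * (fac (n ℕ.+ x) * invFac K * invFac N * sign w * (c * ρ) * (fac v * invFac w))
      ≡⟨ trans (cong (_* W) (invFac-* (K ℕ.+ w))) (ℚₚ.*-identityˡ W) ⟩
    W
      ∎
    where
    open ≡-Reasoning
    r w : ℕ
    r = N ∸ v
    w = n ℕ.+ suc v
    c ρ W : ℚ
    c = ι (N C v)
    ρ = recip (x ℕ.+ v)
    W = fac (n ℕ.+ x) * invFac K * invFac N * sign w * (c * ρ) * (fac v * invFac w)
    x+v≡K+w : x ℕ.+ v ≡ K ℕ.+ w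
    x+v≡K+w = lem N K v
      where
      lem : ∀ N K v → suc N ℕ.+ suc K ℕ.+ v ≡ K ℕ.+ (suc N ℕ.+ suc v)
      lem = ℕSolver.solve-∀
    fac-inverse : fac v * c * invFac N * fac r ≡ 1ℚ
    fac-inverse = begin
      fac v * c * invFac N * fac r     ≡⟨ swap (fac v) c (invFac N) (fac r) ⟩
      invFac N * (c * (fac v * fac r)) ≡⟨ cong (invFac N *_) (subst (λ z → ι (z C v) * (fac v * fac r) ≡ fac z) (ℕₚ.m+[n∸m]≡n v≤N) (binomial-fac v r)) ⟩
      invFac N * fac N                 ≡⟨ invFac-* N ⟩
      1ℚ                               ∎
      where
      swap : ∀ a b c d → a * b * c * d ≡ c * (b * (a * d))
      swap = solve-∀ ℚ-ring
    top : r ℕ.+ suc (x ℕ.+ v) ≡ n ℕ.+ x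
    top = trans (ℕₚ.+-suc r (x ℕ.+ v)) (cong suc (trans (cong (r ℕ.+_) (ℕₚ.+-comm x v))
      (trans (sym (ℕₚ.+-assoc r v x)) (cong (ℕ._+ x) (ℕₚ.m∸n+n≡m v≤N)))))
    first : ι ((n ℕ.+ x) C r) ≡ fac v * c * invFac N * (ρ * invFac (K ℕ.+ w)) * fac (n ℕ.+ x)
    first = begin
      b                                                        ≡⟨ unit b ⟩
      1ℚ * 1ℚ * b                                              ≡⟨ cong₂ (λ p q → p * q * b) fac-inverse (invFac-* (suc (x ℕ.+ v))) ⟨
      fac v * c * invFac N * fac r * (invFac (suc (x ℕ.+ v)) * fac (suc (x ℕ.+ v))) * b
        ≡⟨ swap (fac v * c * invFac N) (fac r) (invFac (suc (x ℕ.+ v))) (fac (suc (x ℕ.+ v))) b ⟩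
      fac v * c * invFac N * invFac (suc (x ℕ.+ v)) * (b * (fac r * fac (suc (x ℕ.+ v))))
        -- `invFac (suc (x + v))` unfolds to `ρ` times `invFac (x + v)`, and the latter will cancel
        -- the factorial in `second`.
        ≡⟨ cong₂ (λ p q → fac v * c * invFac N * (ρ * invFac p) * q) x+v≡K+w
             (subst (λ z → ι (z C r) * (fac r * fac (suc (x ℕ.+ v))) ≡ fac z) top (binomial-fac r (suc (x ℕ.+ v)))) ⟩
      fac v * c * invFac N * (ρ * invFac (K ℕ.+ w)) * fac (n ℕ.+ x) ∎
      where
      b = ι ((n ℕ.+ x) C r)
      unit : ∀ b → b ≡ 1ℚ * 1ℚ * b
      unit = solve-∀ ℚ-ring
      swap : ∀ a r i f b → a * r * (i * f) * b ≡ a * i * (b * (r * f))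
      swap = solve-∀ ℚ-ring
    second : ι ((K ℕ.+ w) C w) ≡ invFac K * invFac w * fac (K ℕ.+ w)
    second = begin
      b                                                   ≡⟨ unit b ⟩
      1ℚ * 1ℚ * b                                         ≡⟨ cong₂ (λ p q → p * q * b) (invFac-* K) (invFac-* w) ⟨
      invFac K * fac K * (invFac w * fac w) * b           ≡⟨ swap (invFac K) (fac K) (invFac w) (fac w) b ⟩
      invFac K * invFac w * (b * (fac w * fac K))         ≡⟨ cong (invFac K * invFac w *_) (subst (λ z → ι (z C w) * (fac w * fac K) ≡ fac z) (ℕₚ.+-comm w K) (binomial-fac w K)) ⟩
      invFac K * invFac w * fac (K ℕ.+ w)                 ∎
      where
      b = ι ((K ℕ.+ w) C w)
      unit : ∀ b → b ≡ 1ℚ * 1ℚ * b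
      unit = solve-∀ ℚ-ring
      swap : ∀ a r i f b → a * r * (i * f) * b ≡ a * i * (b * (f * r))
      swap = solve-∀ ℚ-ring
    shuffle : ∀ a c i ρ j g s k l f → a * c * i * (ρ * j) * g * (s * (k * l * f)) ≡ j * f * (g * k * i * s * (c * ρ) * (a * l))
    shuffle = solve-∀ ℚ-ring

  -- Serves both formulas: f is the polynomial transported so that its nodes are 0, ..., N and its
  -- target is -(x+1), and s absorbs the remaining sign. Of the other signs in the hypothesis,
  -- `sign (n + suc v)` cancels the one in the weight and `sign v` feeds the alternating sum.
  weighted-sum : ∀ (s : ℚ) {f} → Poly N f → (value : ℕ → ℚ) → value 0 ≡ 0ℚ →
    (∀ v → fac v * value (suc v) ≡ s * sign (n ℕ.+ suc v) * sign v * fac (n ℕ.+ suc v) * f (ι v)) →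
    sumℚ n (λ u → weight n x u * value u) ≡ invFac K * (s * (fac x * f (- ι (suc x))))
  weighted-sum s {f} p value value₀ value-suc = begin
    sumℚ n (λ u → weight n x u * value u)
      ≡⟨ sum-first N (λ u → weight n x u * value u) ⟩
    weight n x 0 * value 0 + sumℚ N (λ v → weight n x (suc v) * value (suc v))
      ≡⟨ cong₂ _+_ (trans (cong (weight n x 0 *_) value₀) (ℚₚ.*-zeroʳ (weight n x 0))) (sum-cong-≤ N term) ⟩
    0ℚ + sumℚ N (λ v → A * (ι (N C v) * (sign v * (f (ι v) * recip (x ℕ.+ v)))))
      ≡⟨ trans (ℚₚ.+-identityˡ _) (sum-*ˡ N A (λ v → ι (N C v) * (sign v * (f (ι v) * recip (x ℕ.+ v))))) ⟩
    A * sumℚ N (λ v → ι (N C v) * (sign v * (f (ι v) * recip (x ℕ.+ v))))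
      ≡⟨ cong (A *_) (trans (sym (alternating-sum N (λ v → f (ι v) * recip (x ℕ.+ v)))) (interpolation N x p)) ⟩
    A * (f z * (fac N * fac x * invFac (suc (x ℕ.+ N))))
      ≡⟨ cong (λ i → A * (f z * (fac N * fac x * invFac (suc i)))) (ℕₚ.+-comm x N) ⟩
    A * (f z * (fac N * fac x * invFac (n ℕ.+ x)))
      ≡⟨ shuffle (fac (n ℕ.+ x)) (invFac K) (invFac N) s (f z) (fac N) (fac x) (invFac (n ℕ.+ x)) ⟩
    invFac N * fac N * (invFac (n ℕ.+ x) * fac (n ℕ.+ x)) * (invFac K * (s * (fac x * f z)))
      ≡⟨ cong₂ (λ p q → p * q * (invFac K * (s * (fac x * f z)))) (invFac-* N) (invFac-* (n ℕ.+ x)) ⟩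
    1ℚ * 1ℚ * (invFac K * (s * (fac x * f z)))
      ≡⟨ ℚₚ.*-identityˡ (invFac K * (s * (fac x * f z))) ⟩
    invFac K * (s * (fac x * f z))
      ∎
    where
    open ≡-Reasoning
    z A : ℚ
    z = - ι (suc x)
    A = fac (n ℕ.+ x) * invFac K * invFac N * s
    shuffle : ∀ g k i s f m x j → g * k * i * s * (f * (m * x * j)) ≡ i * m * (j * g) * (k * (s * (x * f)))
    shuffle = solve-∀ ℚ-ring
    term : ∀ v → v ≤ N → weight n x (suc v) * value (suc v) ≡ A * (ι (N C v) * (sign v * (f (ι v) * recip (x ℕ.+ v))))
    term v v≤N = begin
      weight n x (suc v) * value (suc v)
        ≡⟨ cong (_* value (suc v)) (weight-suc v v≤N) ⟩
      B * σ * (ι (N C v) * ρ) * (fac v * i) * value (suc v)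
        ≡⟨ shuffle₁ B σ (ι (N C v)) ρ (fac v) i (value (suc v)) ⟩
      B * σ * (ι (N C v) * ρ) * i * (fac v * value (suc v))
        ≡⟨ cong (B * σ * (ι (N C v) * ρ) * i *_) (value-suc v) ⟩
      B * σ * (ι (N C v) * ρ) * i * (s * σ * sign v * fac w * f (ι v))
        ≡⟨ shuffle₂ B σ (ι (N C v)) ρ i s (sign v) (fac w) (f (ι v)) ⟩
      σ * σ * (i * fac w) * (B * s * (ι (N C v) * (sign v * (f (ι v) * ρ))))
        ≡⟨ cong₂ (λ p q → p * q * (B * s * (ι (N C v) * (sign v * (f (ι v) * ρ))))) (sign-* w) (invFac-* w) ⟩
      1ℚ * 1ℚ * (B * s * (ι (N C v) * (sign v * (f (ι v) * ρ))))
        ≡⟨ ℚₚ.*-identityˡ (B * s * (ι (N C v) * (sign v * (f (ι v) * ρ)))) ⟩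
      B * s * (ι (N C v) * (sign v * (f (ι v) * ρ)))
        ∎
      where
      w : ℕ
      w = n ℕ.+ suc v
      B σ ρ i : ℚ
      B = fac (n ℕ.+ x) * invFac K * invFac N
      σ = sign w
      ρ = recip (x ℕ.+ v)
      i = invFac w
      shuffle₁ : ∀ b σ c ρ a i q → b * σ * (c * ρ) * (a * i) * q ≡ b * σ * (c * ρ) * i * (a * q)
      shuffle₁ = solve-∀ ℚ-ring
      shuffle₂ : ∀ b σ c ρ i s t g f → b * σ * (c * ρ) * i * (s * σ * t * g * f) ≡ σ * σ * (i * g) * (b * s * (c * (t * (f * ρ))))
      shuffle₂ = solve-∀ ℚ-ring

  private
    k : ℕ
    k = suc K

    factored : ∃[ R ] Poly N R × (∀ t → reciprocityPoly n t ≡ t * R t)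
    factored = poly-root-0 (poly-reciprocityPoly n) (reciprocityPoly-at-0 N)

    R : ℚ → ℚ
    R = proj₁ factored

    poly-R : Poly N R
    poly-R = proj₁ (proj₂ factored)

    Q≗ : ∀ t → reciprocityPoly n t ≡ t * R t
    Q≗ = proj₂ (proj₂ factored)

    sign-shift : ∀ v → sign (n ℕ.+ suc v) * sign v ≡ - sign n
    sign-shift v = trans (cong (_* sign v) (exp-+ (- 1ℚ) n (suc v)))
      (trans (swap (sign n) (sign v)) (trans (cong (λ z → - (sign n * z)) (sign-* v)) (cong -_ (ℚₚ.*-identityʳ (sign n)))))
      where
      swap : ∀ a b → a * (- 1ℚ * b) * b ≡ - (a * (b * b))
      swap = solve-∀ ℚ-ring

    fac-x : ∀ j → fac (n ℕ.+ suc j) ≡ ι (n ℕ.+ suc j) * fac (n ℕ.+ j)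
    fac-x j = trans (fac-suc (N ℕ.+ suc j)) (cong (λ i → ι (n ℕ.+ suc j) * fac i) (ℕₚ.+-suc N j))

  ℬ-expansion : ℬ x k ≡ sumℚ n (λ u → weight n x u * 𝒜 (n ℕ.+ u) u)
  ℬ-expansion = begin
    ℬ x k
      ≡⟨ fac-solve k (trans (ℬ-poly n k) (cong (fac x *_) (Q≗ (ι k)))) ⟩
    invFac k * (fac x * (ι k * R (ι k)))
      ≡⟨ shuffle (invFac k) (fac x) (ι k) (R (ι k)) ⟩
    ι k * invFac k * (1ℚ * (fac x * R (ι k)))
      ≡⟨ cong₂ (λ p t → p * (1ℚ * (fac x * R t))) (invFac-suc K) node-x ⟩
    invFac K * (1ℚ * (fac x * f (- ι (suc x))))
      ≡⟨ weighted-sum 1ℚ (poly-affine N (- ι (suc n)) (- 1ℚ) poly-R) (λ u → 𝒜 (n ℕ.+ u) u)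
           (trans (cong (λ i → 𝒜 i 0) (ℕₚ.+-identityʳ n)) (𝒜-suc-0 N)) value ⟨
    sumℚ n (λ u → weight n x u * 𝒜 (n ℕ.+ u) u)
      ∎
    where
    open ≡-Reasoning
    -- t ↦ -(n+1) - t carries 0, ..., N to -(n+1), ..., -2n, and -(x+1) to k.
    f : ℚ → ℚ
    f t = R (- ι (suc n) + - 1ℚ * t)
    shuffle : ∀ i g k r → i * (g * (k * r)) ≡ k * i * (1ℚ * (g * r))
    shuffle = solve-∀ ℚ-ring
    node-x : ι k ≡ - ι (suc n) + - 1ℚ * - ι (suc x)
    node-x = trans (rearrange (ι (suc n)) (ι k)) (cong (λ z → - ι (suc n) + - 1ℚ * - z) (sym (ι-+ (suc n) k)))
      where
      rearrange : ∀ a k → k ≡ - a + - 1ℚ * - (a + k)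
      rearrange = solve-∀ ℚ-ring
    node : ∀ v → - ι (n ℕ.+ suc v) ≡ - ι (suc n) + - 1ℚ * ι v
    node v = trans (cong -_ (trans (cong ι (ℕₚ.+-suc n v)) (ι-+ (suc n) v))) (rearrange (ι (suc n)) (ι v))
      where
      rearrange : ∀ a v → - (a + v) ≡ - a + - 1ℚ * v
      rearrange = solve-∀ ℚ-ring
    value : ∀ v → fac v * 𝒜 (n ℕ.+ suc v) (suc v) ≡ 1ℚ * sign (n ℕ.+ suc v) * sign v * fac (n ℕ.+ suc v) * f (ι v)
    value v = begin
      fac v * 𝒜 w (suc v)
        ≡⟨ 𝒜-poly n v ⟩
      sign n * fac (n ℕ.+ v) * reciprocityPoly n (- ι w)
        ≡⟨ cong (sign n * fac (n ℕ.+ v) *_) (Q≗ (- ι w)) ⟩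
      sign n * fac (n ℕ.+ v) * (- ι w * R (- ι w))
        ≡⟨ pull (sign n) (fac (n ℕ.+ v)) (ι w) (R (- ι w)) ⟩
      - sign n * (ι w * fac (n ℕ.+ v)) * R (- ι w)
        ≡⟨ cong₂ (λ p q → p * q * R (- ι w)) (sign-shift v) (fac-x v) ⟨
      sign w * sign v * fac w * R (- ι w)
        ≡⟨ cong (λ t → sign w * sign v * fac w * R t) (node v) ⟩
      sign w * sign v * fac w * f (ι v)
        ≡⟨ unit (sign w) (sign v) (fac w) (f (ι v)) ⟩
      1ℚ * sign w * sign v * fac w * f (ι v)
        ∎
      where
      w : ℕ
      w = n ℕ.+ suc v
      pull : ∀ s g w r → s * g * (- w * r) ≡ - s * (w * g) * r
      pull = solve-∀ ℚ-ring
      unit : ∀ a b c d → a * b * c * d ≡ 1ℚ * a * b * c * d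
      unit = solve-∀ ℚ-ring

  𝒜-expansion : 𝒜 x k ≡ sumℚ n (λ u → weight n x u * ℬ (n ℕ.+ u) u)
  𝒜-expansion = begin
    𝒜 x k
      ≡⟨ fac-solve K (trans (𝒜-poly n K) (cong (sign n * fac (n ℕ.+ K) *_) (Q≗ (- ι x)))) ⟩
    invFac K * (sign n * fac (n ℕ.+ K) * (- ι x * R (- ι x)))
      ≡⟨ cong (invFac K *_) (pull (sign n) (fac (n ℕ.+ K)) (ι x) (R (- ι x))) ⟩
    invFac K * (- sign n * (ι x * fac (n ℕ.+ K) * R (- ι x)))
      ≡⟨ cong₂ (λ p t → invFac K * (- sign n * (p * R t))) (sym (fac-x K)) node-x ⟩
    invFac K * (- sign n * (fac x * f (- ι (suc x))))
      ≡⟨ weighted-sum (- sign n) (poly-affine N 1ℚ 1ℚ poly-R) (λ u → ℬ (n ℕ.+ u) u) (ℬ-suc-0 N) value ⟨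
    sumℚ n (λ u → weight n x u * ℬ (n ℕ.+ u) u)
      ∎
    where
    open ≡-Reasoning
    -- t ↦ 1 + t carries 0, ..., N to 1, ..., n, and -(x+1) to -x.
    f : ℚ → ℚ
    f t = R (1ℚ + 1ℚ * t)
    pull : ∀ s g w r → s * g * (- w * r) ≡ - s * (w * g * r)
    pull = solve-∀ ℚ-ring
    node-x : - ι x ≡ 1ℚ + 1ℚ * - ι (suc x)
    node-x = trans (rearrange (ι x)) (cong (λ z → 1ℚ + 1ℚ * - z) (sym (ι-suc x)))
      where
      rearrange : ∀ a → - a ≡ 1ℚ + 1ℚ * - (1ℚ + a)
      rearrange = solve-∀ ℚ-ring
    value : ∀ v → fac v * ℬ (n ℕ.+ suc v) (suc v) ≡ - sign n * sign (n ℕ.+ suc v) * sign v * fac (n ℕ.+ suc v) * f (ι v)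
    value v = begin
      fac v * ℬ w (suc v)
        ≡⟨ ι-cancelˡ v cancelled ⟩
      fac w * R (ι (suc v))
        ≡⟨ cong (λ t → fac w * R t) (trans (ι-suc v) (cong (λ z → 1ℚ + z) (sym (ℚₚ.*-identityˡ (ι v))))) ⟩
      fac w * f (ι v)
        ≡⟨ cong (_* f (ι v)) (trans (sym (ℚₚ.*-identityˡ (fac w))) (cong (_* fac w) (sym signs))) ⟩
      - sign n * sign w * sign v * fac w * f (ι v)
        ∎
      where
      w : ℕ
      w = n ℕ.+ suc v
      -- `ℬ-poly` brings (v+1)! on one side, and the root at 0 brings a factor v + 1 on the other;
      -- cancelling it leaves the required v!.
      cancelled : ι (suc v) * (fac v * ℬ w (suc v)) ≡ ι (suc v) * (fac w * R (ι (suc v)))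
      cancelled = begin
        ι (suc v) * (fac v * ℬ w (suc v))         ≡⟨ ℚₚ.*-assoc (ι (suc v)) (fac v) (ℬ w (suc v)) ⟨
        ι (suc v) * fac v * ℬ w (suc v)           ≡⟨ cong (_* ℬ w (suc v)) (fac-suc v) ⟨
        fac (suc v) * ℬ w (suc v)                 ≡⟨ ℬ-poly n (suc v) ⟩
        fac w * reciprocityPoly n (ι (suc v))     ≡⟨ cong (fac w *_) (Q≗ (ι (suc v))) ⟩
        fac w * (ι (suc v) * R (ι (suc v)))       ≡⟨ *-left-comm (fac w) (ι (suc v)) (R (ι (suc v))) ⟩
        ι (suc v) * (fac w * R (ι (suc v)))       ∎
      signs : - sign n * sign w * sign v ≡ 1ℚ
      signs = trans (ℚₚ.*-assoc (- sign n) (sign w) (sign v))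
        (trans (cong (- sign n *_) (sign-shift v)) (trans (neg² (sign n)) (sign-* n)))
        where
        neg² : ∀ s → - s * - s ≡ s * s
        neg² = solve-∀ ℚ-ring

-- Boundary cases and conclusion

weight-0-0 : ∀ k → weight 0 k 0 ≡ 1ℚ
weight-0-0 k = cong toℚ (cong₂ ℤ._*_ (cong +_ (nC0≡1 k)) (trans (cong (λ z → binomℤ z 0) (n-[n+k] 0 k)) (right k)))
  where
  nC0≡1 : ∀ n → n C 0 ≡ 1
  nC0≡1 n = trans (nCk≡nC[n∸k] (z≤n {n})) (nCn≡1 n)
  right : ∀ k → binomℤ (ℤ.- + k) 0 ≡ + 1
  right zero    = refl
  right (suc k) = trans (ℤₚ.*-identityˡ (+ ((k ℕ.+ 0) C 0))) (cong +_ (nC0≡1 (k ℕ.+ 0)))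

weight-suc-diagonal : ∀ n u → weight (suc n) (suc n ℕ.+ 0) u ≡ 0ℚ
weight-suc-diagonal n u = cong toℚ (trans
  (cong (λ z → + ((suc n ℕ.+ (suc n ℕ.+ 0)) C (suc n ∸ u)) ℤ.* binomℤ z (suc n ℕ.+ u)) (n-[n+k] (suc n) 0))
  (trans (cong (λ c → + ((suc n ℕ.+ (suc n ℕ.+ 0)) C (suc n ∸ u)) ℤ.* + c) (k>n⇒nCk≡0 {0} {suc n ℕ.+ u} (s≤s z≤n)))
    (ℤₚ.*-zeroʳ (+ ((suc n ℕ.+ (suc n ℕ.+ 0)) C (suc n ∸ u))))))

ℬ-n-n : ∀ k → ℬ k k ≡ 1ℚ
ℬ-n-n k = trans (fac-solve k (ℬ-poly 0 k)) (trans (cong (λ z → invFac k * z) (ℚₚ.*-identityʳ (fac k))) (invFac-* k))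

𝒜-n-n : ∀ k → 𝒜 k k ≡ 1ℚ
𝒜-n-n zero    = refl
𝒜-n-n (suc k) = trans (fac-solve k (𝒜-poly 0 k)) (trans (cong (λ z → invFac k * z) (unit (fac k))) (invFac-* k))
  where
  unit : ∀ f → 1ℚ * f * 1ℚ ≡ f
  unit = solve-∀ ℚ-ring

-- For n = 0 both sides are 1. For n > 0 and k = 0 the left sides vanish, and on the right the upper
-- index n - x is 0 while the lower index n + u is positive, so every weight is 0.
expansions : ∀ n k →
  (ℬ (n ℕ.+ k) k ≡ sumℚ n (λ u → weight n (n ℕ.+ k) u * 𝒜 (n ℕ.+ u) u)) ×
  (𝒜 (n ℕ.+ k) k ≡ sumℚ n (λ u → weight n (n ℕ.+ k) u * ℬ (n ℕ.+ u) u))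
expansions zero    k       = trans (ℬ-n-n k) (sym (cong (_* 𝒜 0 0) (weight-0-0 k))) , trans (𝒜-n-n k) (sym (cong (_* ℬ 0 0) (weight-0-0 k)))
expansions (suc n) zero    =
  trans (ℬ-suc-0 n) (sym (sum-0 (suc n) (λ u _ → trans (cong (_* 𝒜 (suc n ℕ.+ u) u) (weight-suc-diagonal n u)) (ℚₚ.*-zeroˡ (𝒜 (suc n ℕ.+ u) u))))) ,
  trans (trans (cong (λ i → 𝒜 i 0) (ℕₚ.+-identityʳ (suc n))) (𝒜-suc-0 n))
    (sym (sum-0 (suc n) (λ u _ → trans (cong (_* ℬ (suc n ℕ.+ u) u) (weight-suc-diagonal n u)) (ℚₚ.*-zeroˡ (ℬ (suc n ℕ.+ u) u)))))
expansions (suc n) (suc k) = ℬ-expansion n k , 𝒜-expansion n k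

theorem6p1 : ((n k : ℕ) → ∃[ z ] ℬ n k ≡ toℚ z)
    × ((n k : ℕ) → ∃[ m ] (+ n ℤ.- + k ≡ ℤ.1ℤ ℤ.+ + 2 ℤ.* m) → ℬ n k ≡ 0ℚ)
    × ((n x : ℕ) → n ≤ x →
    (ℬ x (x ∸ n) ≡ sumℚ n (λ u →
    toℚ (binomℤ (+ (n ℕ.+ x)) (n ∸ u) ℤ.* binomℤ (+ n ℤ.- + x) (n ℕ.+ u))
    ℚ.* 𝒜 (n ℕ.+ u) u))
    × (𝒜 x (x ∸ n) ≡ sumℚ n (λ u →
    toℚ (binomℤ (+ (n ℕ.+ x)) (n ∸ u) ℤ.* binomℤ (+ n ℤ.- + x) (n ℕ.+ u))
    ℚ.* ℬ (n ℕ.+ u) u)))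
theorem6p1 = ℬ-int , ℬ-odd , λ n x n≤x →
  subst (λ y → (ℬ y (x ∸ n) ≡ sumℚ n (λ u → weight n y u * 𝒜 (n ℕ.+ u) u))
             × (𝒜 y (x ∸ n) ≡ sumℚ n (λ u → weight n y u * ℬ (n ℕ.+ u) u)))
        (ℕₚ.m+[n∸m]≡n n≤x) (expansions n (x ∸ n))
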